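{- Let $t \ge 4$ be even and let $n \ge 4t + 12$ with $n \equiv 4 \pmod 8$. Let \[ S''_{t, n} = \{1, 2, \ldots, t-1 \} \cup \left\{ \tfrac{n}{4} - 1, \tfrac{n}{4} + 3 \right\} \cup \left\{\tfrac{n}{2} - (t-1), \ldots, \tfrac{n}{2} - 2, \tfrac{n}{2} -1 \right\}. \] Then the circulant graph $\mathrm{Circ}(n, S''_{t, n})$ is a $4t$-regular circulant nut graph of order $n$.
   Context: For $n \ge 2$ and $S \subseteq \{1, 2, \ldots, \lfloor n/2 \rfloor\}$, $\mathrm{Circ}(n, S)$ denotes the simple graph on vertex set $\{0, 1, \ldots, n-1\}$ in which distinct vertices $i, j$ are adjacent if and only if $(j - i) \bmod n \in S$ or $(i - j) \bmod n \in S$. A nut graph is a graph with at least two vertices whose adjacency matrix has nullity exactly one and such that a nonzero vector spanning its null space has no zero entries; a circulant nut graph is a nut graph that is a circulant graph. -}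

module Defs where

open import Data.Bool using (Bool; true; false; _∧_; _∨_; not; if_then_else_)
open import Data.Nat using (ℕ; zero; suc; _+_; _∸_; _≤_; _≤ᵇ_; _≡ᵇ_)
open import Data.Nat.DivMod using (_%_; _/_)
open import Data.Fin using (Fin; toℕ) renaming (zero to fzero; suc to fsuc)
open import Data.Rational using (ℚ; 0ℚ; 1ℚ) renaming (_+_ to _+ℚ_; _*_ to _*ℚ_)
open import Data.Product using (Σ; _×_; ∃)
open import Relation.Binary.PropositionalEquality using (_≡_)
open import Relation.Nullary using (¬_)

Graph : ℕ → Set
Graph n = Fin n → Fin n → Bool

sumFin : ∀ {n} → (Fin n → ℚ) → ℚ
sumFin {zero}  f = 0ℚ
sumFin {suc n} f = f fzero +ℚ sumFin (λ i → f (fsuc i))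

countFin : ∀ {n} → (Fin n → Bool) → ℕ
countFin {zero}  p = 0
countFin {suc n} p = (if p fzero then 1 else 0) + countFin (λ i → p (fsuc i))

Circ : (n : ℕ) → (ℕ → Bool) → Graph n
Circ zero    S ()
Circ (suc m) S i j =
  not (toℕ i ≡ᵇ toℕ j) ∧
  (S ((toℕ j + suc m ∸ toℕ i) % suc m) ∨ S ((toℕ i + suc m ∸ toℕ j) % suc m))

adjMatrix : ∀ {n} → Graph n → Fin n → Fin n → ℚ
adjMatrix G i j = if G i j then 1ℚ else 0ℚ

InKernel : ∀ {n} → Graph n → (Fin n → ℚ) → Set
InKernel G v = ∀ i → sumFin (λ j → adjMatrix G i j *ℚ v j) ≡ 0ℚ

-- Nut graph: at least two vertices; the null space (over ℚ) of the adjacency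
-- matrix has dimension exactly one, i.e. is spanned by a nonzero vector v,
-- and v has no zero entries.
IsNut : ∀ {n} → Graph n → Set
IsNut {n} G =
  2 ≤ n ×
  Σ (Fin n → ℚ) λ v →
    InKernel G v ×
    (∀ i → ¬ (v i ≡ 0ℚ)) ×
    (∀ w → InKernel G w → ∃ λ (c : ℚ) → ∀ i → w i ≡ c *ℚ v i)

IsRegular : ∀ {n} → ℕ → Graph n → Set
IsRegular k G = ∀ i → countFin (G i) ≡ k

inRange : ℕ → ℕ → ℕ → Bool
inRange d e x = (d ≤ᵇ x) ∧ (x ≤ᵇ e)

S'' : ℕ → ℕ → ℕ → Bool
S'' t n d =
  inRange 1 (t ∸ 1) d ∨
  (d ≡ᵇ (n / 4 ∸ 1)) ∨ (d ≡ᵇ (n / 4 + 3)) ∨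
  inRange (n / 2 ∸ (t ∸ 1)) (n / 2 ∸ 1) d

{-# OPTIONS --safe #-}
module Submission where

-- Let T be the cyclic shift, h = n/2 and q = n/4, which is odd. A kernel vector may be taken integral; call it f.
-- Since the blocks {1, …, t − 1} and {h − (t − 1), …, h − 1} are exchanged by h − d, they cancel on
-- u = f − T^h f, leaving (T² − 1)(T⁴ + 1) u = 0; as n ≡ 4 (mod 8) and T^h u = −u this forces u = 0.
-- So T^h f = f, and each row now reads 2(…) + T^(q−3) (1 + T² + T⁴ + T⁶) f = 0. Modulo 2 the polynomial
-- is (1 + T)⁶, so z = T² f − f, whose sums over residue classes modulo 2 vanish, is even; half of z
-- satisfies the same equations, and infinite descent gives z = 0. On 2-periodic functions a row is
-- 2t (f x + f (x + 1)), so the kernel is spanned by (−1)^x, and the constant 1 gives the degree 4t.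

open import Defs
open import Level using (0ℓ)
open import Data.Bool using (Bool; true; false; not; _∧_; _∨_; if_then_else_)
import Data.Bool.Properties as Bool
open import Data.Fin using (Fin; toℕ; fromℕ<) renaming (zero to fzero; suc to fsuc)
open import Data.Fin.Properties using (toℕ<n; toℕ-injective; toℕ-fromℕ<)
open import Data.Integer as ℤ using (ℤ; +_; 0ℤ; 1ℤ; _+_; _-_; _*_; -_; ∣_∣; +[1+_]; -[1+_])
open import Data.Integer.Divisibility.Signed using (_∣_; divides; ∣m∣n⇒∣m+n; ∣m∣n⇒∣m-n; ∣m⇒∣-m; ∣m⇒∣m*n; ∣-refl)
import Data.Integer.Properties as ℤ
open import Data.Integer.Tactic.RingSolver using (solve-∀)
import Data.Nat.Coprimality as Coprime
open import Data.Nat as ℕ using (ℕ; zero; suc; z≤n; s≤s; s≤s⁻¹; _≤_; _<_; _∸_; _≡ᵇ_; _≤ᵇ_)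
open import Data.Nat.DivMod
  using (_%_; _/_; _mod_; m%n<n; m≡m%n+[m/n]*n; m<n⇒m%n≡m; [m+n]%n≡m%n; m*n/n≡m)
import Data.Nat.Properties as ℕ
import Data.Nat.Tactic.RingSolver as ℕSolver
open import Algebra.Properties.CommutativeSemigroup ℕ.+-commutativeSemigroup using () renaming (x∙yz≈y∙xz to +-swap)
open import Data.Product using (Σ; ∃; _×_; _,_; proj₁; proj₂)
open import Data.Rational as ℚ using (ℚ; mkℚ; 0ℚ; 1ℚ; ↥_; ↧_; ↧ₙ_)
import Data.Rational.Properties as ℚ
open import Data.Rational.Unnormalised using (*≡*)
import Data.Rational.Unnormalised.Properties as ℚᵘ
open import Data.Sum using (_⊎_; inj₁; inj₂)
open import Function using (_∘_; mk⇔)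
open import Relation.Binary using (Rel; IsEquivalence)
open import Relation.Binary.PropositionalEquality
open import Relation.Nullary using (¬_; Dec; does; contradiction)
open import Relation.Nullary.Decidable using (_×-dec_; _⊎-dec_; dec-true; dec-false; does-⇔)
open ≡-Reasoning

-- Finite sums and periodic functions

∑ : ℕ → (ℕ → ℤ) → ℤ
∑ zero    f = 0ℤ
∑ (suc n) f = f 0 + ∑ n (f ∘ suc)

∑-cong : ∀ n {f g : ℕ → ℤ} → (∀ i → i < n → f i ≡ g i) → ∑ n f ≡ ∑ n g
∑-cong zero    f≗g = refl
∑-cong (suc n) f≗g = cong₂ _+_ (f≗g 0 (s≤s z≤n)) (∑-cong n λ i i<n → f≗g (suc i) (s≤s i<n))

∑-distrib-- : ∀ n (f g : ℕ → ℤ) → ∑ n (λ i → f i - g i) ≡ ∑ n f - ∑ n g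
∑-distrib-- zero    f g = refl
∑-distrib-- (suc n) f g = trans (cong (_+_ (f 0 - g 0)) (∑-distrib-- n (f ∘ suc) (g ∘ suc)))
  (interchange (f 0) (g 0) (∑ n (f ∘ suc)) (∑ n (g ∘ suc)))
  where
  interchange : ∀ a b c d → a - b + (c - d) ≡ a + c - (b + d)
  interchange = solve-∀

∑-distribʳ-* : ∀ n (f : ℕ → ℤ) c → ∑ n (λ i → f i * c) ≡ ∑ n f * c
∑-distribʳ-* zero    f c = refl
∑-distribʳ-* (suc n) f c = trans (cong (_+_ (f 0 * c)) (∑-distribʳ-* n (f ∘ suc) c))
  (sym (ℤ.*-distribʳ-+ c (f 0) (∑ n (f ∘ suc))))

∑-telescope : ∀ n (f : ℕ → ℤ) → ∑ n (λ i → f (suc i) - f i) ≡ f n - f 0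
∑-telescope zero    f = sym (ℤ.+-inverseʳ (f 0))
∑-telescope (suc n) f = trans (cong (_+_ (f 1 - f 0)) (∑-telescope n (f ∘ suc)))
  (cancel-middle (f 0) (f 1) (f (suc n)))
  where
  cancel-middle : ∀ a b c → b - a + (c - b) ≡ c - a
  cancel-middle = solve-∀

Periodic : {A : Set} → Rel A 0ℓ → ℕ → (ℕ → A) → Set
Periodic _≈_ p f = ∀ x → f (p ℕ.+ x) ≈ f x

module _ {A : Set} {_≈_ : Rel A 0ℓ} (isEquivalence : IsEquivalence _≈_) {f : ℕ → A} {p : ℕ} where
  private module ≈ = IsEquivalence isEquivalence

  periodic-* : ∀ k → Periodic _≈_ p f → Periodic _≈_ (k ℕ.* p) f
  periodic-* zero    f-per x = ≈.refl
  periodic-* (suc k) f-per x =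
    subst (λ y → f y ≈ f x) (sym (ℕ.+-assoc p (k ℕ.* p) x))
      (≈.trans (f-per (k ℕ.* p ℕ.+ x)) (periodic-* k f-per x))

  -- One step of Euclid's algorithm on periods. The relation is an arbitrary equivalence because the
  -- step serves both for equality and for congruence modulo 2.
  periodic-remainder : ∀ k {d} → Periodic _≈_ p f → Periodic _≈_ (k ℕ.* p ℕ.+ d) f → Periodic _≈_ d f
  periodic-remainder k {d} f-per f-per′ x =
    ≈.trans (≈.sym (periodic-* k f-per (d ℕ.+ x)))
      (subst (λ y → f y ≈ f x) (ℕ.+-assoc (k ℕ.* p) d x) (f-per′ x))

-- Antiperiodic solutions of a shift recurrence

i≡-i⇒i≡0 : ∀ {i} → i ≡ - i → i ≡ 0ℤ
i≡-i⇒i≡0 {+ zero}   _ = refl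
i≡-i⇒i≡0 {+[1+ _ ]} ()
i≡-i⇒i≡0 { -[1+ _ ]} ()

-- (T² − 1)(T⁴ + 1) u = 0 for the shift T, so d = (T² − 1) u satisfies T⁴ d = − d and T⁸ d = d;
-- as the period of d is 4 modulo 8, also T⁴ d = d.
antiperiodic⇒0 : ∀ m (u : ℕ → ℤ) → (∀ y → u (suc m ℕ.* 4 ℕ.+ 2 ℕ.+ y) ≡ - u y) →
  (∀ y → u (2 ℕ.+ y) + u (6 ℕ.+ y) ≡ u y + u (4 ℕ.+ y)) → ∀ y → u y ≡ 0ℤ
antiperiodic⇒0 m u u-anti u-rec y =
  i≡-i⇒i≡0 (trans (sym (u-per-h y)) (u-anti y))
  where
  h = suc m ℕ.* 4 ℕ.+ 2
  d : ℕ → ℤ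
  d y = u (2 ℕ.+ y) - u y

  d-anti : ∀ y → d (4 ℕ.+ y) ≡ - d y
  d-anti y = begin
    u (6 ℕ.+ y) - u (4 ℕ.+ y)
      ≡⟨ rearrange (u y) (u (2 ℕ.+ y)) (u (4 ℕ.+ y)) (u (6 ℕ.+ y)) ⟩
    u (2 ℕ.+ y) + u (6 ℕ.+ y) - (u y + u (4 ℕ.+ y)) - d y
      ≡⟨ cong (λ i → i - (u y + u (4 ℕ.+ y)) - d y) (u-rec y) ⟩
    u y + u (4 ℕ.+ y) - (u y + u (4 ℕ.+ y)) - d y
      ≡⟨ cancel (u y + u (4 ℕ.+ y)) (d y) ⟩
    - d y ∎
    where
    rearrange : ∀ a b c e → e - c ≡ b + e - (a + c) - (b - a)
    rearrange = solve-∀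
    cancel : ∀ a b → a - a - b ≡ - b
    cancel = solve-∀

  d-per-8 : Periodic _≡_ 8 d
  d-per-8 y = trans (d-anti (4 ℕ.+ y)) (trans (cong -_ (d-anti y)) (ℤ.neg-involutive (d y)))

  u-per-2h : ∀ y → u (h ℕ.+ (h ℕ.+ y)) ≡ u y
  u-per-2h y = trans (u-anti (h ℕ.+ y)) (trans (cong -_ (u-anti y)) (ℤ.neg-involutive (u y)))

  -- `h + h` is `8 (m + 1) + 4`, so removing multiples of the period 8 leaves 4.
  d-per-2h : Periodic _≡_ (suc m ℕ.* 8 ℕ.+ 4) d
  d-per-2h y = cong₂ _-_
    (trans (cong u (shift₁ m y)) (u-per-2h (2 ℕ.+ y))) (trans (cong u (shift₂ m y)) (u-per-2h y))
    where
    shift₁ : ∀ m y → 2 ℕ.+ (suc m ℕ.* 8 ℕ.+ 4 ℕ.+ y)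
      ≡ suc m ℕ.* 4 ℕ.+ 2 ℕ.+ (suc m ℕ.* 4 ℕ.+ 2 ℕ.+ (2 ℕ.+ y))
    shift₁ = ℕSolver.solve-∀
    shift₂ : ∀ m y → suc m ℕ.* 8 ℕ.+ 4 ℕ.+ y
      ≡ suc m ℕ.* 4 ℕ.+ 2 ℕ.+ (suc m ℕ.* 4 ℕ.+ 2 ℕ.+ y)
    shift₂ = ℕSolver.solve-∀

  d≡0 : ∀ y → d y ≡ 0ℤ
  d≡0 y = i≡-i⇒i≡0
    (trans (sym (periodic-remainder isEquivalence (suc m) d-per-8 d-per-2h y)) (d-anti y))

  u-per-2 : Periodic _≡_ 2 u
  u-per-2 y = ℤ.i-j≡0⇒i≡j (u (2 ℕ.+ y)) (u y) (d≡0 y)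

  -- `h` is even, so period 2 gives period `h`; together with antiperiodicity this makes each value
  -- its own negative.
  u-per-h : Periodic _≡_ h u
  u-per-h y = trans (cong (λ k → u (k ℕ.+ y)) (even m)) (periodic-* isEquivalence (suc m ℕ.* 2 ℕ.+ 1) u-per-2 y)
    where
    even : ∀ m → suc m ℕ.* 4 ℕ.+ 2 ≡ (suc m ℕ.* 2 ℕ.+ 1) ℕ.* 2
    even = ℕSolver.solve-∀

-- Congruence modulo 2

infix 4 _≡₂_
_≡₂_ : Rel ℤ 0ℓ
i ≡₂ j = + 2 ∣ i - j

≡₂-isEquivalence : IsEquivalence _≡₂_
≡₂-isEquivalence = record
  { refl  = λ {i} → divides 0ℤ (ℤ.+-inverseʳ i)
  ; sym   = λ {i} {j} i≡j → subst (+ 2 ∣_) (neg-sub i j) (∣m⇒∣-m i≡j)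
  ; trans = λ {i} {j} {k} i≡j j≡k → subst (+ 2 ∣_) (chain i j k) (∣m∣n⇒∣m+n i≡j j≡k)
  }
  where
  neg-sub : ∀ i j → - (i - j) ≡ j - i
  neg-sub = solve-∀
  chain : ∀ i j k → (i - j) + (j - k) ≡ i - k
  chain = solve-∀

∑-≡₂-const : ∀ n (f : ℕ → ℤ) c → (∀ i → f i ≡₂ c) → ∑ n f ≡₂ + n * c
∑-≡₂-const zero    f c f≡c = divides 0ℤ refl
∑-≡₂-const (suc n) f c f≡c = subst (+ 2 ∣_) (collect (f 0) c (∑ n (f ∘ suc)) (+ n))
  (∣m∣n⇒∣m+n (f≡c 0) (∑-≡₂-const n (f ∘ suc) c (f≡c ∘ suc)))
  where
  collect : ∀ a c s k → (a - c) + (s - k * c) ≡ a + s - (1ℤ + k) * c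
  collect = solve-∀

-- The row equation on functions of period n/2

block : ℕ → (ℕ → ℤ) → ℕ → ℤ
block b f y = ∑ b (λ e → f (e ℕ.+ y))

window : (ℕ → ℤ) → ℕ → ℤ
window f y = f y + f (2 ℕ.+ y) + (f (4 ℕ.+ y) + f (6 ℕ.+ y))

twice : ℤ → ℤ
twice i = i + i

-- What a row of the adjacency matrix becomes on functions of period n/2; p stands for n/4 − 3.
reducedRow : (b s p : ℕ) → (ℕ → ℤ) → ℕ → ℤ
reducedRow b s p f x = twice (block b f (1 ℕ.+ x) + block b f (s ℕ.+ x)) + window f (p ℕ.+ x)

block-periodic : ∀ b {p f} → Periodic _≡_ p f → Periodic _≡_ p (block b f)
block-periodic b {p} {f} f-per y =
  ∑-cong b λ e _ → trans (cong f (+-swap e p y)) (f-per (e ℕ.+ y))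

block-shift-- : ∀ b d f y → block b (λ y → f (d ℕ.+ y) - f y) y ≡ block b f (d ℕ.+ y) - block b f y
block-shift-- b d f y = trans (∑-distrib-- b (λ e → f (d ℕ.+ (e ℕ.+ y))) (λ e → f (e ℕ.+ y)))
  (cong (_- block b f y) (∑-cong b λ e _ → cong f (+-swap d e y)))

-- Infinite descent on the reduced row equation

module Descent (b s j : ℕ) where

  -- `q` is odd by construction and `p = q - 3`, so `p + p + 6` is the full period `q * 2`.
  q p : ℕ
  q = suc j ℕ.* 2 ℕ.+ 1
  p = j ℕ.* 2

  -- The conditions that survive halving. The third excludes (-1)^x, which for odd `b` and `s`
  -- satisfies the first two but whose sums over `q` equal terms are `q` or `- q`.
  record NullSolution (z : ℕ → ℤ) : Set where
    field
      periodic  : Periodic _≡_ (q ℕ.* 2) z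
      row≡0     : ∀ x → reducedRow b s p z x ≡ 0ℤ
      ∑-even≡0  : ∀ x → ∑ q (λ i → z (i ℕ.* 2 ℕ.+ x)) ≡ 0ℤ

  open NullSolution

  -- Modulo 2 the row equation reads T^p (T + 1)^6 z = 0 for the shift T. Hence T^8 z = z, and the
  -- period 2q of z is 2 modulo 4, so T² z = z modulo 2; summing over the odd number q of terms gives z = 0.
  null⇒even : ∀ {z} → NullSolution z → ∀ x → + 2 ∣ z x
  -- As `q` is odd, `z x = - (q * z x) + (q + 1) * z x` has both terms even.
  null⇒even {z} Z x = subst (+ 2 ∣_) (recover (z x) (+ suc j))
    (∣m∣n⇒∣m+n (subst (λ k → + 2 ∣ - (k * z x)) q≡ 2∣qz) (∣m⇒∣m*n ((+ suc j + 1ℤ) * z x) ∣-refl))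
    where
    ≡₂-reflexive : ∀ {a b} → a ≡ b → a ≡₂ b
    ≡₂-reflexive = IsEquivalence.reflexive ≡₂-isEquivalence

    window-even : ∀ x → + 2 ∣ window z (p ℕ.+ x)
    window-even x = divides (- B) (trans (isolate B (window z (p ℕ.+ x)))
        (trans (cong (_- twice B) (row≡0 Z x)) (negate B)))
      where
      B = block b z (1 ℕ.+ x) + block b z (s ℕ.+ x)
      isolate : ∀ B w → w ≡ B + B + w - (B + B)
      isolate = solve-∀
      negate : ∀ B → 0ℤ - (B + B) ≡ - B * + 2
      negate = solve-∀

    -- This uses (T² - 1)(1 + T² + T⁴ + T⁶) = T⁸ - 1. The window is known to be even only from `p`
    -- on; `r` is chosen so that `p + r` is `y` plus the full period.
    per-8 : Periodic _≡₂_ 8 z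
    per-8 y = subst (+ 2 ∣_)
      (trans (difference (z₀ 0) (z₀ 2) (z₀ 4) (z₀ 6) (z₀ 8)) (cong₂ _-_ (back 8) (back 0)))
      (∣m∣n⇒∣m-n (subst (λ y → + 2 ∣ window z y) (shift 2) (window-even (2 ℕ.+ r)))
        (window-even r))
      where
      r = j ℕ.* 2 ℕ.+ 6 ℕ.+ y
      z₀ : ℕ → ℤ
      z₀ k = z (k ℕ.+ (p ℕ.+ r))
      shift : ∀ k → p ℕ.+ (k ℕ.+ r) ≡ k ℕ.+ (p ℕ.+ r)
      shift k = +-swap p k r
      back : ∀ k → z₀ k ≡ z (k ℕ.+ y)
      back k = trans (cong z (swap j k y)) (periodic Z (k ℕ.+ y))
        where
        swap : ∀ j k y → k ℕ.+ (j ℕ.* 2 ℕ.+ (j ℕ.* 2 ℕ.+ 6 ℕ.+ y))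
          ≡ (suc j ℕ.* 2 ℕ.+ 1) ℕ.* 2 ℕ.+ (k ℕ.+ y)
        swap = ℕSolver.solve-∀
      difference : ∀ a b c d e → b + c + (d + e) - (a + b + (c + d)) ≡ e - a
      difference = solve-∀

    -- Since `4q = 8 (j + 1) + 4` and `2q = 4 (j + 1) + 2`, Euclid's step lowers the period from 8
    -- to 4 and then to 2.
    per-4 : Periodic _≡₂_ 4 z
    per-4 = periodic-remainder ≡₂-isEquivalence {f = z} (suc j) per-8
      λ y → ≡₂-reflexive (trans (cong (λ k → z (k ℕ.+ y)) (double j)) (periodic-* isEquivalence 2 (periodic Z) y))
      where
      double : ∀ j → suc j ℕ.* 8 ℕ.+ 4 ≡ 2 ℕ.* ((suc j ℕ.* 2 ℕ.+ 1) ℕ.* 2)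
      double = ℕSolver.solve-∀

    per-2 : Periodic _≡₂_ 2 z
    per-2 = periodic-remainder ≡₂-isEquivalence {f = z} (suc j) per-4
      λ y → ≡₂-reflexive (trans (cong (λ k → z (k ℕ.+ y)) (split j)) (periodic Z y))
      where
      split : ∀ j → suc j ℕ.* 4 ℕ.+ 2 ≡ (suc j ℕ.* 2 ℕ.+ 1) ℕ.* 2
      split = ℕSolver.solve-∀

    2∣qz : + 2 ∣ - (+ q * z x)
    2∣qz = subst (+ 2 ∣_) (trans (cong (_- + q * z x) (∑-even≡0 Z x)) (ℤ.+-identityˡ (- (+ q * z x))))
      (∑-≡₂-const q (λ i → z (i ℕ.* 2 ℕ.+ x)) (z x) λ i → periodic-* ≡₂-isEquivalence {f = z} i per-2 x)

    q≡ = cong (λ k → k + 1ℤ) (ℤ.pos-* (suc j) 2)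

    recover : ∀ c k → - ((k * + 2 + 1ℤ) * c) + + 2 * ((k + 1ℤ) * c) ≡ c
    recover = solve-∀

  -- All three conditions are linear and homogeneous, so the common factor 2 cancels.
  half-null : ∀ {z} (y : ℕ → ℤ) → (∀ x → z x ≡ y x * + 2) → NullSolution z → NullSolution y
  half-null {z} y z≡2y Z = record
    { periodic = λ x → cancel-2 (trans (sym (z≡2y (q ℕ.* 2 ℕ.+ x))) (trans (periodic Z x) (z≡2y x)))
    ; row≡0    = λ x → cancel-2 (trans (sym (row x)) (row≡0 Z x))
    ; ∑-even≡0 = λ x → cancel-2 (trans (sym (∑-half q (λ i → i ℕ.* 2 ℕ.+ x))) (∑-even≡0 Z x))
    }
    where
    cancel-2 : ∀ {a b} → a * + 2 ≡ b * + 2 → a ≡ b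
    cancel-2 {a} {b} = ℤ.*-cancelʳ-≡ a b (+ 2)
    ∑-half : ∀ n (e : ℕ → ℕ) → ∑ n (z ∘ e) ≡ ∑ n (y ∘ e) * + 2
    ∑-half n e = trans (∑-cong n λ i _ → z≡2y (e i)) (∑-distribʳ-* n (y ∘ e) (+ 2))
    -- Abstracting blocks and values into variables and matching the equations with `refl` leaves
    -- the ring solver a plain polynomial identity.
    combine : ∀ a a′ v₀ v₂ v₄ v₆ {B B′ w₀ w₂ w₄ w₆} → B ≡ a * + 2 → B′ ≡ a′ * + 2 →
      w₀ ≡ v₀ * + 2 → w₂ ≡ v₂ * + 2 → w₄ ≡ v₄ * + 2 → w₆ ≡ v₆ * + 2 →
      twice (B + B′) + (w₀ + w₂ + (w₄ + w₆)) ≡ (twice (a + a′) + (v₀ + v₂ + (v₄ + v₆))) * + 2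
    combine a a′ v₀ v₂ v₄ v₆ refl refl refl refl refl refl = collect a a′ v₀ v₂ v₄ v₆
      where
      collect : ∀ a b c d e f → (a * + 2 + b * + 2) + (a * + 2 + b * + 2) + (c * + 2 + d * + 2 + (e * + 2 + f * + 2))
        ≡ ((a + b) + (a + b) + (c + d + (e + f))) * + 2
      collect = solve-∀
    row : ∀ x → reducedRow b s p z x ≡ reducedRow b s p y x * + 2
    row x = combine (block b y (1 ℕ.+ x)) (block b y (s ℕ.+ x))
      (y w) (y (2 ℕ.+ w)) (y (4 ℕ.+ w)) (y (6 ℕ.+ w))
      (∑-half b (λ e → e ℕ.+ (1 ℕ.+ x))) (∑-half b (λ e → e ℕ.+ (s ℕ.+ x)))
      (z≡2y w) (z≡2y (2 ℕ.+ w)) (z≡2y (4 ℕ.+ w)) (z≡2y (6 ℕ.+ w))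
      where
      w = p ℕ.+ x

  -- The induction is on a bound for the absolute value at the fixed point `x`, while the solution
  -- changes: half of a null solution is again one, with a strictly smaller bound at `x`.
  null⇒0 : ∀ {z} → NullSolution z → ∀ x → z x ≡ 0ℤ
  null⇒0 {z} Z x = bounded ∣ z x ∣ Z ℕ.≤-refl
    where
    bounded : ∀ m {z} → NullSolution z → ∣ z x ∣ ≤ m → z x ≡ 0ℤ
    bounded zero    Z ∣zx∣≤0 = ℤ.∣i∣≡0⇒i≡0 (ℕ.n≤0⇒n≡0 ∣zx∣≤0)
    bounded (suc m) Z ∣zx∣≤1+m = trans (z≡2y x) (cong (_* + 2) (bounded m (half-null y z≡2y Z)
      (halve (subst (_≤ suc m) (trans (cong ∣_∣ (z≡2y x)) (ℤ.abs-* (y x) (+ 2))) ∣zx∣≤1+m))))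
      where
      y : ℕ → ℤ
      y x = _∣_.quotient (null⇒even Z x)
      z≡2y = λ x → _∣_.equality (null⇒even Z x)
      halve : ∀ {k} → k ℕ.* 2 ≤ suc m → k ≤ m
      halve {zero}  _         = z≤n
      halve {suc k} (s≤s 1+k*2≤m) = ℕ.≤-trans (s≤s (ℕ.m≤m*n k 2)) 1+k*2≤m

  -- The descent applies to T² f - f: its rows are differences of rows of `f`, and its sum over `q`
  -- steps of 2 telescopes to `f (q * 2 + x) - f x`, which is zero.
  reducedRow≡0⇒period2 : ∀ {f} → Periodic _≡_ (q ℕ.* 2) f → (∀ x → reducedRow b s p f x ≡ 0ℤ) →
    Periodic _≡_ 2 f
  reducedRow≡0⇒period2 {f} f-per row≡0 x = ℤ.i-j≡0⇒i≡j (f (2 ℕ.+ x)) (f x) (null⇒0 Δ-null x)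
    where
    Δ : ℕ → ℤ
    Δ y = f (2 ℕ.+ y) - f y
    shift-per : ∀ y → f (2 ℕ.+ (q ℕ.* 2 ℕ.+ y)) ≡ f (2 ℕ.+ y)
    shift-per y = trans (cong f (+-swap 2 (q ℕ.* 2) y)) (f-per (2 ℕ.+ y))
    window-Δ : ∀ y → window Δ y ≡ window f (2 ℕ.+ y) - window f y
    window-Δ y = collect (f y) (f (2 ℕ.+ y)) (f (4 ℕ.+ y)) (f (6 ℕ.+ y)) (f (8 ℕ.+ y))
      where
      collect : ∀ a b c d e → b - a + (c - b) + (d - c + (e - d)) ≡ b + c + (d + e) - (a + b + (c + d))
      collect = solve-∀
    combine : ∀ a a′ b b′ w w′ {B B′ W} → B ≡ a - a′ → B′ ≡ b - b′ → W ≡ w - w′ →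
      twice (B + B′) + W ≡ (twice (a + b) + w) - (twice (a′ + b′) + w′)
    combine a a′ b b′ w w′ refl refl refl = collect a a′ b b′ w w′
      where
      collect : ∀ a a′ b b′ w w′ → ((a - a′) + (b - b′)) + ((a - a′) + (b - b′)) + (w - w′)
        ≡ ((a + b) + (a + b) + w) - ((a′ + b′) + (a′ + b′) + w′)
      collect = solve-∀
    row : ∀ x → reducedRow b s p Δ x ≡ reducedRow b s p f (2 ℕ.+ x) - reducedRow b s p f x
    row x = combine
      (block b f (3 ℕ.+ x)) (block b f (1 ℕ.+ x)) (block b f (s ℕ.+ (2 ℕ.+ x))) (block b f (s ℕ.+ x))
      (window f (p ℕ.+ (2 ℕ.+ x))) (window f (p ℕ.+ x))
      (block-shift-- b 2 f (1 ℕ.+ x))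
      (trans (block-shift-- b 2 f (s ℕ.+ x)) (cong (λ y → block b f y - block b f (s ℕ.+ x)) (+-swap 2 s x)))
      (trans (window-Δ (p ℕ.+ x)) (cong (λ y → window f y - window f (p ℕ.+ x)) (+-swap 2 p x)))
    Δ-null : NullSolution Δ
    Δ-null = record
      { periodic = λ y → cong₂ _-_ (shift-per y) (f-per y)
      ; row≡0    = λ x → trans (row x) (cong₂ _-_ (row≡0 (2 ℕ.+ x)) (row≡0 x))
      ; ∑-even≡0 = λ x → trans (∑-telescope q (λ i → f (i ℕ.* 2 ℕ.+ x)))
                     (ℤ.i≡j⇒i-j≡0 (f-per x))
      }

-- Rows of the adjacency matrix

-- With b = t − 1, s = n/2 − b, h = n/2 and p = n/4 − 3 this is the sum of f over the neighbours of x;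
-- offsets below n/2 are on the first line, offsets n − d with d in S'' on the second.
row : (b s h p : ℕ) → (ℕ → ℤ) → ℕ → ℤ
row b s h p f x =
  (block b f (1 ℕ.+ x) + (f (2 ℕ.+ (p ℕ.+ x)) + f (6 ℕ.+ (p ℕ.+ x))) + block b f (s ℕ.+ x)) +
  (block b f (h ℕ.+ (1 ℕ.+ x)) + (f (h ℕ.+ (p ℕ.+ x)) + f (h ℕ.+ (4 ℕ.+ (p ℕ.+ x)))) + block b f (h ℕ.+ (s ℕ.+ x)))

block-shift : ∀ b d f y → block b (f ∘ (d ℕ.+_)) y ≡ block b f (d ℕ.+ y)
block-shift b d f y = ∑-cong b λ e _ → cong f (+-swap d e y)

row-cong : ∀ b s h p {f g} → (∀ x → f x ≡ g x) → ∀ x → row b s h p f x ≡ row b s h p g x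
row-cong b s h p f≗g x = cong₂ _+_ (side _ _ (f≗g _) (f≗g _)) (side _ _ (f≗g _) (f≗g _))
  where
  side : ∀ y z {u v u′ v′} → u ≡ u′ → v ≡ v′ → _
  side y z u≡ v≡ = cong₂ _+_ (cong₂ _+_ (∑-cong b λ e _ → f≗g (e ℕ.+ y)) (cong₂ _+_ u≡ v≡))
    (∑-cong b λ e _ → f≗g (e ℕ.+ z))

row-shift : ∀ b s h p d f x → row b s h p (f ∘ (d ℕ.+_)) x ≡ row b s h p f (d ℕ.+ x)
row-shift b s h p d f x = cong₂ _+_
  (cong₂ _+_ (cong₂ _+_ (blk 1) (cong₂ _+_ (pt 2) (pt 6))) (blk s))
  (cong₂ _+_ (cong₂ _+_ (blk′ 1) (cong₂ _+_ (pt′ 0) (pt′ 4))) (blk′ s))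
  where
  blk : ∀ k → block b (f ∘ (d ℕ.+_)) (k ℕ.+ x) ≡ block b f (k ℕ.+ (d ℕ.+ x))
  blk k = trans (block-shift b d f (k ℕ.+ x)) (cong (block b f) (+-swap d k x))
  blk′ : ∀ k → block b (f ∘ (d ℕ.+_)) (h ℕ.+ (k ℕ.+ x)) ≡ block b f (h ℕ.+ (k ℕ.+ (d ℕ.+ x)))
  blk′ k = trans (block-shift b d f (h ℕ.+ (k ℕ.+ x)))
    (cong (block b f) (trans (+-swap d h (k ℕ.+ x)) (cong (h ℕ.+_) (+-swap d k x))))
  index : ∀ k → d ℕ.+ (k ℕ.+ (p ℕ.+ x)) ≡ k ℕ.+ (p ℕ.+ (d ℕ.+ x))
  index k = trans (+-swap d k (p ℕ.+ x)) (cong (k ℕ.+_) (+-swap d p x))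
  pt : ∀ k → f (d ℕ.+ (k ℕ.+ (p ℕ.+ x))) ≡ f (k ℕ.+ (p ℕ.+ (d ℕ.+ x)))
  pt k = cong f (index k)
  pt′ : ∀ k → f (d ℕ.+ (h ℕ.+ (k ℕ.+ (p ℕ.+ x)))) ≡ f (h ℕ.+ (k ℕ.+ (p ℕ.+ (d ℕ.+ x))))
  pt′ k = cong f (trans (+-swap d h (k ℕ.+ (p ℕ.+ x))) (cong (h ℕ.+_) (index k)))

-- Dropping `h` from the offsets doubles the blocks and interleaves the isolated offsets `2 + p`,
-- `6 + p` with `p`, `4 + p` into one window.
row-h-periodic : ∀ b s h p {f} → Periodic _≡_ h f → ∀ x → row b s h p f x ≡ reducedRow b s p f x
row-h-periodic b s h p {f} f-per x = trans
  (cong (_+_ (block b f (1 ℕ.+ x) + (f (2 ℕ.+ y) + f (6 ℕ.+ y)) + block b f (s ℕ.+ x)))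
    (cong₂ _+_ (cong₂ _+_ (block-periodic b f-per (1 ℕ.+ x)) (cong₂ _+_ (f-per y) (f-per (4 ℕ.+ y))))
      (block-periodic b f-per (s ℕ.+ x))))
  (collect (block b f (1 ℕ.+ x)) (block b f (s ℕ.+ x)) (f y) (f (2 ℕ.+ y)) (f (4 ℕ.+ y)) (f (6 ℕ.+ y)))
  where
  y = p ℕ.+ x
  collect : ∀ B C a b c d → (B + (b + d) + C) + (B + (a + c) + C) ≡ (B + C) + (B + C) + (a + b + (c + d))
  collect = solve-∀

module _ (b s j : ℕ) where
  open Descent b s j using (q; p)

  private
    h = q ℕ.* 2

  -- Shifting a row by `h` swaps its two lines up to the isolated offsets. In the difference of the
  -- rows at `x` and `h + x` the blocks therefore cancel, and the isolated terms give the recurrence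
  -- for `u`.
  row≡0⇒h-periodic : ∀ {f} → Periodic _≡_ (h ℕ.+ h) f → (∀ x → row b s h p f x ≡ 0ℤ) → Periodic _≡_ h f
  row≡0⇒h-periodic {f} f-per row≡0 x = sym (ℤ.i-j≡0⇒i≡j _ _ (antiperiodic⇒0 j u
      (λ y → trans (cong (λ k → u (k ℕ.+ y)) (sym (h≡ j))) (u-anti y)) u-rec x))
    where
    h≡ : ∀ j → (suc j ℕ.* 2 ℕ.+ 1) ℕ.* 2 ≡ suc j ℕ.* 4 ℕ.+ 2
    h≡ = ℕSolver.solve-∀
    g u : ℕ → ℤ
    g y = f (h ℕ.+ y)
    u y = f y - g y

    g-h : ∀ y → g (h ℕ.+ y) ≡ f y
    g-h y = trans (cong f (sym (ℕ.+-assoc h h y))) (f-per y)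

    u-anti : ∀ y → u (h ℕ.+ y) ≡ - u y
    u-anti y = trans (cong (_-_ (g y)) (g-h y)) (neg-sub (g y) (f y))
      where
      neg-sub : ∀ a b → a - b ≡ - (b - a)
      neg-sub = solve-∀

    block-h : ∀ y → block b f (h ℕ.+ y) ≡ block b g y
    block-h y = sym (block-shift b h f y)

    block-g-h : ∀ y → block b g (h ℕ.+ y) ≡ block b f y
    block-g-h y = trans (sym (block-shift b h g y)) (∑-cong b λ e _ → g-h (e ℕ.+ y))

    u-rec-p : ∀ x → let y = p ℕ.+ x in u (2 ℕ.+ y) + u (6 ℕ.+ y) ≡ u y + u (4 ℕ.+ y)
    u-rec-p x = ℤ.i-j≡0⇒i≡j _ _ (begin
      u (2 ℕ.+ y) + u (6 ℕ.+ y) - (u y + u (4 ℕ.+ y))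
        ≡⟨ difference (block b f (1 ℕ.+ x)) (block b f (s ℕ.+ x)) (block b g (1 ℕ.+ x)) (block b g (s ℕ.+ x))
             (f y) (f (2 ℕ.+ y)) (f (4 ℕ.+ y)) (f (6 ℕ.+ y)) (g y) (g (2 ℕ.+ y)) (g (4 ℕ.+ y)) (g (6 ℕ.+ y)) ⟩
      _ ≡⟨ sym (cong₂ _-_ row-f row-g) ⟩
      row b s h p f x - row b s h p g x
        ≡⟨ cong₂ _-_ (row≡0 x) (trans (row-shift b s h p h f x) (row≡0 (h ℕ.+ x))) ⟩
      0ℤ ∎)
      where
      y = p ℕ.+ x
      row-f : row b s h p f x ≡
        (block b f (1 ℕ.+ x) + (f (2 ℕ.+ y) + f (6 ℕ.+ y)) + block b f (s ℕ.+ x)) +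
        (block b g (1 ℕ.+ x) + (g y + g (4 ℕ.+ y)) + block b g (s ℕ.+ x))
      row-f = cong₂ (λ B C → block b f (1 ℕ.+ x) + (f (2 ℕ.+ y) + f (6 ℕ.+ y)) + block b f (s ℕ.+ x)
          + (B + (g y + g (4 ℕ.+ y)) + C))
        (block-h (1 ℕ.+ x)) (block-h (s ℕ.+ x))
      row-g : row b s h p g x ≡
        (block b g (1 ℕ.+ x) + (g (2 ℕ.+ y) + g (6 ℕ.+ y)) + block b g (s ℕ.+ x)) +
        (block b f (1 ℕ.+ x) + (f y + f (4 ℕ.+ y)) + block b f (s ℕ.+ x))
      row-g = cong (_+_ (block b g (1 ℕ.+ x) + (g (2 ℕ.+ y) + g (6 ℕ.+ y)) + block b g (s ℕ.+ x)))
        (cong₂ _+_ (cong₂ _+_ (block-g-h (1 ℕ.+ x)) (cong₂ _+_ (g-h y) (g-h (4 ℕ.+ y)))) (block-g-h (s ℕ.+ x)))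
      difference : ∀ B C D E a b c d a′ b′ c′ d′ →
        (b - b′) + (d - d′) - ((a - a′) + (c - c′)) ≡
        ((B + (b + d) + C) + (D + (a′ + c′) + E)) - ((D + (b′ + d′) + E) + (B + (a + c) + C))
      difference = solve-∀

    -- So far the recurrence holds only from `p` on. Evaluating it at `h + y = p + (j * 2 + 6 + y)`
    -- and using antiperiodicity brings it back to `y` with both signs flipped.
    u-rec : ∀ y → u (2 ℕ.+ y) + u (6 ℕ.+ y) ≡ u y + u (4 ℕ.+ y)
    u-rec y = ℤ.neg-injective (begin
      - (u (2 ℕ.+ y) + u (6 ℕ.+ y))      ≡⟨ neg-u 2 6 ⟩
      u (2 ℕ.+ (h ℕ.+ y)) + u (6 ℕ.+ (h ℕ.+ y)) ≡⟨ at-h ⟩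
      u (h ℕ.+ y) + u (4 ℕ.+ (h ℕ.+ y))  ≡⟨ sym (neg-u 0 4) ⟩
      - (u y + u (4 ℕ.+ y))              ∎)
      where
      h-split : ∀ j y → j ℕ.* 2 ℕ.+ (j ℕ.* 2 ℕ.+ 6 ℕ.+ y) ≡ (suc j ℕ.* 2 ℕ.+ 1) ℕ.* 2 ℕ.+ y
      h-split = ℕSolver.solve-∀
      at-h : u (2 ℕ.+ (h ℕ.+ y)) + u (6 ℕ.+ (h ℕ.+ y)) ≡ u (h ℕ.+ y) + u (4 ℕ.+ (h ℕ.+ y))
      at-h = subst (λ y → u (2 ℕ.+ y) + u (6 ℕ.+ y) ≡ u y + u (4 ℕ.+ y)) (h-split j y) (u-rec-p (j ℕ.* 2 ℕ.+ 6 ℕ.+ y))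
      neg-u : ∀ k l → - (u (k ℕ.+ y) + u (l ℕ.+ y)) ≡ u (k ℕ.+ (h ℕ.+ y)) + u (l ℕ.+ (h ℕ.+ y))
      neg-u k l = trans (ℤ.neg-distrib-+ (u (k ℕ.+ y)) (u (l ℕ.+ y)))
        (sym (cong₂ _+_ (anti k) (anti l)))
        where
        anti : ∀ k → u (k ℕ.+ (h ℕ.+ y)) ≡ - u (k ℕ.+ y)
        anti k = trans (cong u (+-swap k h y)) (u-anti (k ℕ.+ y))

-- Rows on functions of period 2

block-period2 : ∀ a {f} → Periodic _≡_ 2 f → ∀ y → block (suc (a ℕ.* 2)) f y ≡ (+ a + 1ℤ) * f y + + a * f (suc y)
block-period2 zero {f} f-per y = base (f y) (f (suc y))
  where
  base : ∀ a b → a + 0ℤ ≡ (0ℤ + 1ℤ) * a + 0ℤ * b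
  base = solve-∀
block-period2 (suc a) {f} f-per y = begin
  f y + (f (suc y) + ∑ (suc (a ℕ.* 2)) (λ e → f (2 ℕ.+ (e ℕ.+ y))))
    ≡⟨ cong (λ B → f y + (f (suc y) + B)) (∑-cong (suc (a ℕ.* 2)) λ e _ → f-per (e ℕ.+ y)) ⟩
  f y + (f (suc y) + block (suc (a ℕ.* 2)) f y)
    ≡⟨ cong (λ B → f y + (f (suc y) + B)) (block-period2 a f-per y) ⟩
  f y + (f (suc y) + ((+ a + 1ℤ) * f y + + a * f (suc y)))
    ≡⟨ step (f y) (f (suc y)) (+ a) ⟩
  (1ℤ + + a + 1ℤ) * f y + (1ℤ + + a) * f (suc y) ∎
  where
  step : ∀ u v a → u + (v + ((a + 1ℤ) * u + a * v)) ≡ (1ℤ + a + 1ℤ) * u + (1ℤ + a) * v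
  step = solve-∀

-- Both blocks start at the parity of `x + 1` and have odd length, so each is
-- `(a + 1) * f (x + 1) + a * f x`. The window sees only the parity of `x`, and its four terms
-- balance the two coefficients.
reducedRow-period2 : ∀ a σ j {f} → Periodic _≡_ 2 f → ∀ x →
  reducedRow (suc (a ℕ.* 2)) (suc (σ ℕ.* 2)) (j ℕ.* 2) f x ≡ + suc a * + 4 * (f x + f (suc x))
reducedRow-period2 a σ j {f} f-per x = begin
  reducedRow b s p f x
    ≡⟨ cong₂ (λ B w → twice B + w) (cong₂ _+_ (block-odd 0) (block-odd σ))
         (cong₂ _+_ (cong₂ _+_ (even 0) (even 1)) (cong₂ _+_ (even 2) (even 3))) ⟩
  _ ≡⟨ collect (f x) (f (suc x)) (+ a) ⟩
  + suc a * + 4 * (f x + f (suc x)) ∎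
  where
  b = suc (a ℕ.* 2)
  s = suc (σ ℕ.* 2)
  p = j ℕ.* 2
  block-odd : ∀ k → block b f (suc (k ℕ.* 2) ℕ.+ x) ≡ (+ a + 1ℤ) * f (suc x) + + a * f x
  block-odd k = trans (cong (block b f) (sym (ℕ.+-suc (k ℕ.* 2) x)))
    (trans (periodic-* isEquivalence k (block-periodic b f-per) (suc x))
      (trans (block-period2 a f-per (suc x)) (cong (λ v → (+ a + 1ℤ) * f (suc x) + + a * v) (f-per x))))
  even : ∀ k → f (k ℕ.* 2 ℕ.+ (p ℕ.+ x)) ≡ f x
  even k = trans (periodic-* isEquivalence k f-per (p ℕ.+ x)) (periodic-* isEquivalence j f-per x)
  collect : ∀ u v a →
    ((((a + 1ℤ) * v + a * u) + ((a + 1ℤ) * v + a * u)) + (((a + 1ℤ) * v + a * u) + ((a + 1ℤ) * v + a * u)))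
    + (u + u + (u + u))
    ≡ (1ℤ + a) * + 4 * (u + v)
  collect = solve-∀

module _ (a σ j : ℕ) where
  private
    b = suc (a ℕ.* 2)
    s = suc (σ ℕ.* 2)
    q = suc j ℕ.* 2 ℕ.+ 1
    p = j ℕ.* 2
    h = q ℕ.* 2

  row-period2 : ∀ {f} → Periodic _≡_ 2 f → ∀ x → row b s h p f x ≡ + suc a * + 4 * (f x + f (suc x))
  row-period2 f-per x = trans (row-h-periodic b s h p (periodic-* isEquivalence q f-per) x)
    (reducedRow-period2 a σ j f-per x)

  row≡0⇒alternating : ∀ {f} → Periodic _≡_ (h ℕ.+ h) f → (∀ x → row b s h p f x ≡ 0ℤ) →
    ∀ x → f (suc x) ≡ - f x
  row≡0⇒alternating {f} f-per row≡0 x = begin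
    f (suc x)             ≡⟨ isolate (f x) (f (suc x)) ⟩
    f x + f (suc x) - f x ≡⟨ cong (_- f x) pair≡0 ⟩
    0ℤ - f x              ≡⟨ ℤ.+-identityˡ (- f x) ⟩
    - f x                 ∎
    where
    f-per-h : Periodic _≡_ h f
    f-per-h = row≡0⇒h-periodic b s j f-per row≡0
    f-per-2 : Periodic _≡_ 2 f
    f-per-2 = Descent.reducedRow≡0⇒period2 b s j f-per-h
      λ x → trans (sym (row-h-periodic b s h p f-per-h x)) (row≡0 x)
    isolate : ∀ u v → v ≡ u + v - u
    isolate = solve-∀
    pair≡0 : f x + f (suc x) ≡ 0ℤ
    pair≡0 = ℤ.*-cancelˡ-≡ (+ suc a * + 4) (f x + f (suc x)) 0ℤ
      (trans (trans (sym (row-period2 f-per-2 x)) (row≡0 x)) (sym (ℤ.*-zeroʳ (+ suc a * + 4))))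

-- The connection set

Member : (b c c′ s e : ℕ) → ℕ → Set
Member b c c′ s e d = (1 ≤ d × d ≤ b) ⊎ d ≡ c ⊎ d ≡ c′ ⊎ (s ≤ d × d ≤ e)

-- Assembled in the order of `S''`, so that `does` of it unfolds to the same Boolean expression.
member? : ∀ b c c′ s e d → Dec (Member b c c′ s e d)
member? b c c′ s e d =
  (1 ℕ.≤? d ×-dec d ℕ.≤? b) ⊎-dec d ℕ.≟ c ⊎-dec d ℕ.≟ c′ ⊎-dec (s ℕ.≤? d ×-dec d ℕ.≤? e)

gate : (ℕ → Bool) → (ℕ → ℤ) → ℕ → ℤ
gate χ g d = if χ d then g d else 0ℤ

segment : (ℕ → ℤ) → ℕ → ℕ → ℤ
segment f o n = ∑ n (λ i → f (o ℕ.+ i))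

∑-split : ∀ m n f → ∑ (m ℕ.+ n) f ≡ ∑ m f + segment f m n
∑-split zero    n f = sym (ℤ.+-identityˡ (∑ n f))
∑-split (suc m) n f = trans (cong (_+_ (f 0)) (∑-split m n (f ∘ suc)))
  (sym (ℤ.+-assoc (f 0) (∑ m (f ∘ suc)) (segment f (suc m) n)))

segment-split : ∀ f o m n → segment f o (m ℕ.+ n) ≡ segment f o m + segment f (o ℕ.+ m) n
segment-split f o m n = trans (∑-split m n (λ i → f (o ℕ.+ i)))
  (cong (_+_ (segment f o m)) (∑-cong n λ i _ → cong f (sym (ℕ.+-assoc o m i))))

∑-zero : ∀ n {f} → (∀ i → i < n → f i ≡ 0ℤ) → ∑ n f ≡ 0ℤ
∑-zero zero    f≡0 = refl
∑-zero (suc n) f≡0 = cong₂ _+_ (f≡0 0 (s≤s z≤n)) (∑-zero n λ i i<n → f≡0 (suc i) (s≤s i<n))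

module _ (b s₁ s₂ : ℕ) where
  private
    c = suc b ℕ.+ s₁
    s = c ℕ.+ 1 ℕ.+ 3 ℕ.+ 1 ℕ.+ s₂

  -- The range below `h` is cut into 0, the first block, a gap of length `s₁`, the point `c`, a gap
  -- of 3, the point `c + 4`, a gap of length `s₂`, and the last block. The endpoints enter through
  -- equations so that one proof serves both halves of a row.
  ∑-member : ∀ {c₀ c′ s₀ e h} → c₀ ≡ c → c′ ≡ c₀ ℕ.+ 4 → s₀ ≡ s → suc e ≡ h → s₀ ℕ.+ b ≡ h → ∀ g →
    ∑ h (gate (does ∘ member? b c₀ c′ s₀ e) g) ≡ segment g 1 b + (g c₀ + g c′) + segment g s₀ b
  ∑-member {e = e} refl refl refl 1+e refl g = begin
    ∑ (s ℕ.+ b) F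
    ≡⟨ cong (λ n → ∑ n F) (regroup b s₁ s₂) ⟩
    F 0 + segment F 1 (b ℕ.+ (s₁ ℕ.+ (1 ℕ.+ (3 ℕ.+ (1 ℕ.+ (s₂ ℕ.+ b))))))
      ≡⟨ cong₂ _+_ (F-out 0 (outside (λ ()) (λ ()) (λ ()) (s≤s z≤n))) splits ⟩
    0ℤ + (segment g 1 b + (0ℤ + ((g (c ℕ.+ 0) + 0ℤ) + (0ℤ + ((g (c ℕ.+ 1 ℕ.+ 3 ℕ.+ 0) + 0ℤ) + (0ℤ + segment g s b))))))
      ≡⟨ cong₂ (λ u v → 0ℤ + (segment g 1 b + (0ℤ + ((g u + 0ℤ) + (0ℤ + ((g v + 0ℤ) + (0ℤ + segment g s b)))))))
           (ℕ.+-identityʳ c) (c+4 c) ⟩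
    0ℤ + (segment g 1 b + (0ℤ + ((g c + 0ℤ) + (0ℤ + ((g (c ℕ.+ 4) + 0ℤ) + (0ℤ + segment g s b))))))
      ≡⟨ collect (segment g 1 b) (g c) (g (c ℕ.+ 4)) (segment g s b) ⟩
    segment g 1 b + (g c + g (c ℕ.+ 4)) + segment g s b ∎
    where
    M : ℕ → Set
    M = Member b c (c ℕ.+ 4) s e
    F = gate (does ∘ member? b c (c ℕ.+ 4) s e) g

    regroup : ∀ b s₁ s₂ → suc b ℕ.+ s₁ ℕ.+ 1 ℕ.+ 3 ℕ.+ 1 ℕ.+ s₂ ℕ.+ b
      ≡ suc (b ℕ.+ (s₁ ℕ.+ (1 ℕ.+ (3 ℕ.+ (1 ℕ.+ (s₂ ℕ.+ b))))))
    regroup = ℕSolver.solve-∀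
    c+4 : ∀ c → c ℕ.+ 1 ℕ.+ 3 ℕ.+ 0 ≡ c ℕ.+ 4
    c+4 = ℕSolver.solve-∀
    collect : ∀ w x y z → 0ℤ + (w + (0ℤ + ((x + 0ℤ) + (0ℤ + ((y + 0ℤ) + (0ℤ + z)))))) ≡ w + (x + y) + z
    collect = solve-∀

    F-in : ∀ d → M d → F d ≡ g d
    F-in d d∈ = cong (λ β → if β then g d else 0ℤ) (dec-true (member? b c (c ℕ.+ 4) s e d) d∈)
    F-out : ∀ d → ¬ M d → F d ≡ 0ℤ
    F-out d d∉ = cong (λ β → if β then g d else 0ℤ) (dec-false (member? b c (c ℕ.+ 4) s e d) d∉)

    c+4<s : c ℕ.+ 4 < s
    c+4<s = subst (suc (c ℕ.+ 4) ≤_) (lem c s₂) (ℕ.m≤m+n (suc (c ℕ.+ 4)) s₂)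
      where
      lem : ∀ c s₂ → suc (c ℕ.+ 4) ℕ.+ s₂ ≡ c ℕ.+ 1 ℕ.+ 3 ℕ.+ 1 ℕ.+ s₂
      lem = ℕSolver.solve-∀
    c<c+4 : c < c ℕ.+ 4
    c<c+4 = ℕ.m<m+n c (s≤s z≤n)
    b<c : b < c
    b<c = ℕ.m≤m+n (suc b) s₁

    outside : ∀ {d} → (1 ≤ d → b < d) → d ≢ c → d ≢ c ℕ.+ 4 → d < s → ¬ M d
    outside b<d d≢c d≢c′ d<s (inj₁ (1≤d , d≤b))                = ℕ.<⇒≱ (b<d 1≤d) d≤b
    outside b<d d≢c d≢c′ d<s (inj₂ (inj₁ d≡c))                 = d≢c d≡c
    outside b<d d≢c d≢c′ d<s (inj₂ (inj₂ (inj₁ d≡c′)))         = d≢c′ d≡c′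
    outside b<d d≢c d≢c′ d<s (inj₂ (inj₂ (inj₂ (s≤d , _))))    = ℕ.<⇒≱ d<s s≤d

    below : ∀ {d} → b < d → d < c → ¬ M d
    below b<d d<c = outside (λ _ → b<d) (ℕ.<⇒≢ d<c) (ℕ.<⇒≢ (ℕ.<-trans d<c c<c+4))
      (ℕ.<-trans d<c (ℕ.<-trans c<c+4 c+4<s))
    between : ∀ {d} → c < d → d < c ℕ.+ 4 → ¬ M d
    between c<d d<c′ = outside (λ _ → ℕ.<-trans b<c c<d) (ℕ.>⇒≢ c<d) (ℕ.<⇒≢ d<c′) (ℕ.<-trans d<c′ c+4<s)
    above : ∀ {d} → c ℕ.+ 4 < d → d < s → ¬ M d
    above c′<d d<s = outside (λ _ → ℕ.<-trans b<c c<d) (ℕ.>⇒≢ c<d) (ℕ.>⇒≢ c′<d) d<s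
      where c<d = ℕ.<-trans c<c+4 c′<d

    inside : ∀ o n → (∀ i → i < n → M (o ℕ.+ i)) → segment F o n ≡ segment g o n
    inside o n ∈M = ∑-cong n λ i i<n → F-in (o ℕ.+ i) (∈M i i<n)
    gap : ∀ o n → (∀ i → i < n → ¬ M (o ℕ.+ i)) → segment F o n ≡ 0ℤ
    gap o n ∉M = ∑-zero n λ i i<n → F-out (o ℕ.+ i) (∉M i i<n)

    c+1+3≡c+4 : c ℕ.+ 1 ℕ.+ 3 ≡ c ℕ.+ 4
    c+1+3≡c+4 = ℕ.+-assoc c 1 3

    next : ∀ o m n {u v} → segment F o m ≡ u → segment F (o ℕ.+ m) n ≡ v → segment F o (m ℕ.+ n) ≡ u + v
    next o m n u≡ v≡ = trans (segment-split F o m n) (cong₂ _+_ u≡ v≡)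

    splits =
      next 1 b (s₁ ℕ.+ (5 ℕ.+ (s₂ ℕ.+ b))) (inside 1 b λ i i<b → inj₁ (s≤s z≤n , i<b)) (
      next (suc b) s₁ (5 ℕ.+ (s₂ ℕ.+ b)) (gap (suc b) s₁ λ i i<s₁ → below (ℕ.m≤m+n (suc b) i) (ℕ.+-monoʳ-< (suc b) i<s₁)) (
      next c 1 (4 ℕ.+ (s₂ ℕ.+ b)) (inside c 1 λ { 0 _ → inj₂ (inj₁ (ℕ.+-identityʳ c)) ; (suc _) (s≤s ()) }) (
      next (c ℕ.+ 1) 3 (1 ℕ.+ (s₂ ℕ.+ b)) (gap (c ℕ.+ 1) 3 λ i i<3 → between
        (ℕ.<-≤-trans (ℕ.m<m+n c (s≤s z≤n)) (ℕ.m≤m+n (c ℕ.+ 1) i))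
        (subst (c ℕ.+ 1 ℕ.+ i <_) c+1+3≡c+4 (ℕ.+-monoʳ-< (c ℕ.+ 1) i<3))) (
      next (c ℕ.+ 1 ℕ.+ 3) 1 (s₂ ℕ.+ b) (inside (c ℕ.+ 1 ℕ.+ 3) 1 λ
        { 0 _ → inj₂ (inj₂ (inj₁ (trans (ℕ.+-identityʳ (c ℕ.+ 1 ℕ.+ 3)) c+1+3≡c+4))) ; (suc _) (s≤s ()) }) (
      next (c ℕ.+ 1 ℕ.+ 3 ℕ.+ 1) s₂ b (gap (c ℕ.+ 1 ℕ.+ 3 ℕ.+ 1) s₂ λ i i<s₂ → above
        (subst (λ k → k < c ℕ.+ 1 ℕ.+ 3 ℕ.+ 1 ℕ.+ i) c+1+3≡c+4
          (ℕ.<-≤-trans (ℕ.m<m+n (c ℕ.+ 1 ℕ.+ 3) (s≤s z≤n)) (ℕ.m≤m+n (c ℕ.+ 1 ℕ.+ 3 ℕ.+ 1) i)))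
        (ℕ.+-monoʳ-< (c ℕ.+ 1 ℕ.+ 3 ℕ.+ 1) i<s₂))
      (inside s b λ i i<b → inj₂ (inj₂ (inj₂ (ℕ.m≤m+n s i ,
        s≤s⁻¹ (subst (suc (s ℕ.+ i) ≤_) (sym 1+e) (ℕ.+-monoʳ-< s i<b)))))))))))

-- Neighbour sums in a circulant graph

module _ (m : ℕ) (S : ℕ → Bool) where
  private n = suc m

  adjacent : ℕ → ℕ → Bool
  adjacent x y = not (x ≡ᵇ y) ∧ (S ((y ℕ.+ n ∸ x) % n) ∨ S ((x ℕ.+ n ∸ y) % n))

  -- Adjacency as a function of the distance; the guard `1 ≤ᵇ d` takes over the test that the
  -- vertices are distinct.
  linked : ℕ → Bool
  linked d = (1 ≤ᵇ d) ∧ (S d ∨ S (n ∸ d))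

  ≡ᵇ-refl : ∀ x → (x ≡ᵇ x) ≡ true
  ≡ᵇ-refl x = dec-true (x ℕ.≟ x) refl

  ≡ᵇ-+suc : ∀ x d → (x ≡ᵇ x ℕ.+ suc d) ≡ false
  ≡ᵇ-+suc x d = dec-false (x ℕ.≟ x ℕ.+ suc d) (ℕ.m≢1+m+n x ∘ λ eq → trans eq (ℕ.+-suc x d))

  adjacent-comm : ∀ x y → adjacent x y ≡ adjacent y x
  adjacent-comm x y = cong₂ (λ u v → not u ∧ v)
    (does-⇔ (mk⇔ sym sym) (x ℕ.≟ y) (y ℕ.≟ x))
    (Bool.∨-comm (S ((y ℕ.+ n ∸ x) % n)) (S ((x ℕ.+ n ∸ y) % n)))

  adjacent-linked : ∀ x d → x ℕ.+ d < n → adjacent x (x ℕ.+ d) ≡ linked d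
  adjacent-linked x zero    x+d<n = cong (λ u → not u ∧ (S ((x ℕ.+ 0 ℕ.+ n ∸ x) % n) ∨ S ((x ℕ.+ n ∸ (x ℕ.+ 0)) % n)))
    (trans (cong (x ≡ᵇ_) (ℕ.+-identityʳ x)) (≡ᵇ-refl x))
  adjacent-linked x (suc d) x+d<n = cong₂ (λ u v → not u ∧ v) (≡ᵇ-+suc x d)
    (cong₂ (λ u v → S u ∨ S v) forward backward)
    where
    d<n : suc d < n
    d<n = ℕ.≤-<-trans (ℕ.m≤n+m (suc d) x) x+d<n
    forward : (x ℕ.+ suc d ℕ.+ n ∸ x) % n ≡ suc d
    forward = begin
      (x ℕ.+ suc d ℕ.+ n ∸ x) % n   ≡⟨ cong (λ k → (k ∸ x) % n) (ℕ.+-assoc x (suc d) n) ⟩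
      (x ℕ.+ (suc d ℕ.+ n) ∸ x) % n ≡⟨ cong (_% n) (ℕ.m+n∸m≡n x (suc d ℕ.+ n)) ⟩
      (suc d ℕ.+ n) % n             ≡⟨ [m+n]%n≡m%n (suc d) n ⟩
      suc d % n                     ≡⟨ m<n⇒m%n≡m d<n ⟩
      suc d                         ∎
    backward : (x ℕ.+ n ∸ (x ℕ.+ suc d)) % n ≡ n ∸ suc d
    backward = begin
      (x ℕ.+ n ∸ (x ℕ.+ suc d)) % n ≡⟨ cong (_% n) (ℕ.[m+n]∸[m+o]≡n∸o x n (suc d)) ⟩
      (n ∸ suc d) % n               ≡⟨ m<n⇒m%n≡m (ℕ.∸-monoʳ-< {n} {suc d} {0} (s≤s z≤n) (ℕ.<⇒≤ d<n)) ⟩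
      n ∸ suc d                     ∎

  linked-reflect : ∀ d → 1 ≤ d → d < n → linked (n ∸ d) ≡ linked d
  linked-reflect d 1≤d d<n = begin
    (1 ≤ᵇ n ∸ d) ∧ (S (n ∸ d) ∨ S (n ∸ (n ∸ d)))
      ≡⟨ cong₂ (λ u v → u ∧ (S (n ∸ d) ∨ S v))
           (dec-true (1 ℕ.≤? n ∸ d) (ℕ.m<n⇒0<n∸m d<n)) (ℕ.m∸[m∸n]≡n (ℕ.<⇒≤ d<n)) ⟩
    S (n ∸ d) ∨ S d
      ≡⟨ Bool.∨-comm (S (n ∸ d)) (S d) ⟩
    S d ∨ S (n ∸ d)
      ≡⟨ cong (_∧ (S d ∨ S (n ∸ d))) (sym (dec-true (1 ℕ.≤? d) 1≤d)) ⟩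
    linked d ∎

  -- The vertices are cut at `x`. Those from `x` on have distances below `n ∸ x`; those before `x`
  -- are reached by wrapping around and supply the remaining distances, so the two pieces change
  -- places.
  ∑-adjacent : ∀ f → Periodic _≡_ n f → ∀ x → x < n →
    ∑ n (gate (adjacent x) f) ≡ ∑ n (gate linked (λ d → f (d ℕ.+ x)))
  ∑-adjacent f f-per x x<n = begin
    ∑ n F                                ≡⟨ cong (λ k → ∑ k F) (sym x+r) ⟩
    ∑ (x ℕ.+ r) F                        ≡⟨ ∑-split x r F ⟩
    ∑ x F + segment F x r                ≡⟨ cong₂ _+_ (∑-cong x left) (∑-cong r right) ⟩
    segment G r x + ∑ r G                ≡⟨ ℤ.+-comm (segment G r x) (∑ r G) ⟩
    ∑ r G + segment G r x                ≡⟨ sym (∑-split r x G) ⟩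
    ∑ (r ℕ.+ x) G                        ≡⟨ cong (λ k → ∑ k G) (trans (ℕ.+-comm r x) x+r) ⟩
    ∑ n G                                ∎
    where
    F = gate (adjacent x) f
    G = gate linked (λ d → f (d ℕ.+ x))
    r = n ∸ x
    x+r : x ℕ.+ r ≡ n
    x+r = ℕ.m+[n∸m]≡n (ℕ.<⇒≤ x<n)
    right : ∀ d → d < r → F (x ℕ.+ d) ≡ G d
    right d d<r = cong₂ (λ u v → if u then f v else 0ℤ)
      (adjacent-linked x d (subst (x ℕ.+ d <_) x+r (ℕ.+-monoʳ-< x d<r))) (ℕ.+-comm x d)
    left : ∀ y → y < x → F y ≡ G (r ℕ.+ y)
    left y y<x = cong₂ (λ u v → if u then v else 0ℤ) adj≡ (sym (trans (cong f r+y+x) (f-per y)))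
      where
      e = x ∸ y
      y+e : y ℕ.+ e ≡ x
      y+e = ℕ.m+[n∸m]≡n (ℕ.<⇒≤ y<x)
      e≤x : e ≤ x
      e≤x = ℕ.m∸n≤m x y
      n∸e : n ∸ e ≡ r ℕ.+ y
      n∸e = begin
        n ∸ e                  ≡⟨ cong (_∸ e) (trans (sym x+r) (cong (ℕ._+ r) (trans (sym y+e) (ℕ.+-comm y e)))) ⟩
        e ℕ.+ y ℕ.+ r ∸ e      ≡⟨ cong (_∸ e) (ℕ.+-assoc e y r) ⟩
        e ℕ.+ (y ℕ.+ r) ∸ e    ≡⟨ ℕ.m+n∸m≡n e (y ℕ.+ r) ⟩
        y ℕ.+ r                ≡⟨ ℕ.+-comm y r ⟩
        r ℕ.+ y                ∎
      r+y+x : r ℕ.+ y ℕ.+ x ≡ n ℕ.+ y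
      r+y+x = trans (rotate r y x) (cong (ℕ._+ y) x+r)
        where
        rotate : ∀ r y x → r ℕ.+ y ℕ.+ x ≡ x ℕ.+ r ℕ.+ y
        rotate = ℕSolver.solve-∀
      adj≡ : adjacent x y ≡ linked (r ℕ.+ y)
      adj≡ = begin
        adjacent x y          ≡⟨ adjacent-comm x y ⟩
        adjacent y x          ≡⟨ cong (adjacent y) (sym y+e) ⟩
        adjacent y (y ℕ.+ e)  ≡⟨ adjacent-linked y e (subst (_< n) (sym y+e) x<n) ⟩
        linked e              ≡⟨ sym (linked-reflect e (ℕ.m<n⇒0<n∸m y<x) (ℕ.≤-<-trans e≤x x<n)) ⟩
        linked (n ∸ e)        ≡⟨ cong linked n∸e ⟩
        linked (r ℕ.+ y)      ∎

-- Distances in the graph, split at half the order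

-- The reflection `d ↦ h - d` exchanges the two blocks and reverses the order of the isolated
-- points, hence `γ′` before `γ`.
Member-reflect : ∀ {b c c′ s e h γ γ′} → s ℕ.+ b ≡ h → suc e ≡ h → c ℕ.+ γ ≡ h → c′ ℕ.+ γ′ ≡ h →
  ∀ {d d′} → d ℕ.+ d′ ≡ h → Member b c c′ s e d → Member b γ′ γ s e d′
Member-reflect {b} {s = s} {e} s+b 1+e c+γ c′+γ′ {d} {d′} d+d′ = λ where
  (inj₁ (1≤d , d≤b)) → inj₂ (inj₂ (inj₂
    ( ℕ.+-cancelʳ-≤ b s d′ (subst₂ _≤_ (trans d+d′ (sym s+b)) (ℕ.+-comm b d′) (ℕ.+-monoˡ-≤ d′ d≤b))
    , s≤s⁻¹ (subst (suc d′ ≤_) (trans d+d′ (sym 1+e)) (ℕ.+-monoˡ-≤ d′ 1≤d)))))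
  (inj₂ (inj₁ refl)) → inj₂ (inj₂ (inj₁ (ℕ.+-cancelˡ-≡ d _ _ (trans d+d′ (sym c+γ)))))
  (inj₂ (inj₂ (inj₁ refl))) → inj₂ (inj₁ (ℕ.+-cancelˡ-≡ d _ _ (trans d+d′ (sym c′+γ′))))
  (inj₂ (inj₂ (inj₂ (s≤d , d≤e)))) → inj₁
    ( ℕ.+-cancelˡ-≤ e 1 d′ (subst₂ _≤_ (trans d+d′ (trans (sym 1+e) (ℕ.+-comm 1 e))) refl (ℕ.+-monoˡ-≤ d′ d≤e))
    , ℕ.+-cancelˡ-≤ s d′ b (subst (s ℕ.+ d′ ≤_) (trans d+d′ (sym s+b)) (ℕ.+-monoˡ-≤ d′ s≤d)))

-- q = n/4 and p = q − 3; ρ measures the slack in the hypothesis 4t + 12 ≤ n, n being 4t + 12 + 8ρ.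
module Parameters (a ρ : ℕ) where
  j σ t b p q h n s : ℕ
  j = suc a ℕ.+ ρ
  σ = 4 ℕ.+ a ℕ.+ ρ ℕ.* 2
  t = 2 ℕ.+ a ℕ.* 2
  b = suc (a ℕ.* 2)
  p = j ℕ.* 2
  q = suc j ℕ.* 2 ℕ.+ 1
  h = q ℕ.* 2
  n = h ℕ.+ h
  s = suc (σ ℕ.* 2)

  s+b≡h : s ℕ.+ b ≡ h
  s+b≡h = lemma a ρ
    where
    lemma : ∀ a ρ → suc ((4 ℕ.+ a ℕ.+ ρ ℕ.* 2) ℕ.* 2) ℕ.+ suc (a ℕ.* 2)
      ≡ (suc (suc a ℕ.+ ρ) ℕ.* 2 ℕ.+ 1) ℕ.* 2
    lemma = ℕSolver.solve-∀

  -- h + d is adjacent to 0 exactly when h − d lies in S'', which turns the isolated distances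
  -- q − 1, q + 3 of `near` into q − 3, q + 1 in `far`.
  near far : ℕ → Set
  near = Member b (2 ℕ.+ p) (6 ℕ.+ p) s (h ∸ 1)
  far = Member b p (4 ℕ.+ p) s (h ∸ 1)

  near? : ∀ d → Dec (near d)
  near? = member? b (2 ℕ.+ p) (6 ℕ.+ p) s (h ∸ 1)
  far? : ∀ d → Dec (far d)
  far? = member? b p (4 ℕ.+ p) s (h ∸ 1)

  S''≡near : ∀ d → S'' t n d ≡ does (near? d)
  S''≡near d = begin
    S'' t n d
      ≡⟨ cong₂ (λ u v → does (member? b (u ∸ 1) (u ℕ.+ 3) (v ∸ b) (v ∸ 1) d)) n/4 n/2 ⟩
    does (member? b (q ∸ 1) (q ℕ.+ 3) (h ∸ b) (h ∸ 1) d)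
      ≡⟨ cong (λ u → does (member? b (q ∸ 1) (q ℕ.+ 3) u (h ∸ 1) d)) h∸b ⟩
    does (member? b (q ∸ 1) (q ℕ.+ 3) s (h ∸ 1) d)
      ≡⟨ cong₂ (λ u v → does (member? b u v s (h ∸ 1) d)) (ℕ.m+n∸n≡m (suc j ℕ.* 2) 1) (q+3 j) ⟩
    does (near? d) ∎
    where
    quadruple : ∀ q → q ℕ.* 2 ℕ.+ q ℕ.* 2 ≡ q ℕ.* 4
    quadruple = ℕSolver.solve-∀
    double : ∀ h → h ℕ.+ h ≡ h ℕ.* 2
    double = ℕSolver.solve-∀
    n/4 : n / 4 ≡ q
    n/4 = trans (cong (_/ 4) (quadruple q)) (m*n/n≡m q 4)
    n/2 : n / 2 ≡ h
    n/2 = trans (cong (_/ 2) (double h)) (m*n/n≡m h 2)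
    h∸b : h ∸ b ≡ s
    h∸b = trans (cong (_∸ b) (sym s+b≡h)) (ℕ.m+n∸n≡m s b)
    q+3 : ∀ j → suc j ℕ.* 2 ℕ.+ 1 ℕ.+ 3 ≡ 6 ℕ.+ j ℕ.* 2
    q+3 = ℕSolver.solve-∀

  b<h : b < h
  b<h = subst (b <_) s+b≡h (ℕ.m<n+m b {s} (s≤s z≤n))

  2+p+4+p : 2 ℕ.+ p ℕ.+ (4 ℕ.+ p) ≡ h
  2+p+4+p = lemma j
    where
    lemma : ∀ j → 2 ℕ.+ j ℕ.* 2 ℕ.+ (4 ℕ.+ j ℕ.* 2) ≡ (suc j ℕ.* 2 ℕ.+ 1) ℕ.* 2
    lemma = ℕSolver.solve-∀

  6+p+p : 6 ℕ.+ p ℕ.+ p ≡ h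
  6+p+p = lemma j
    where
    lemma : ∀ j → 6 ℕ.+ j ℕ.* 2 ℕ.+ j ℕ.* 2 ≡ (suc j ℕ.* 2 ℕ.+ 1) ℕ.* 2
    lemma = ℕSolver.solve-∀

  near-bounds : ∀ {d} → near d → 1 ≤ d × d < h
  near-bounds (inj₁ (1≤d , d≤b)) = 1≤d , ℕ.≤-<-trans d≤b b<h
  near-bounds (inj₂ (inj₁ refl)) = s≤s z≤n , subst (2 ℕ.+ p <_) 2+p+4+p (ℕ.m<m+n (2 ℕ.+ p) (s≤s z≤n))
  near-bounds (inj₂ (inj₂ (inj₁ refl))) = s≤s z≤n , subst (6 ℕ.+ p <_) 6+p+p (ℕ.m<m+n (6 ℕ.+ p) (s≤s z≤n))
  near-bounds (inj₂ (inj₂ (inj₂ (s≤d , d≤e)))) = ℕ.≤-trans (s≤s z≤n) s≤d , s≤s d≤e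

  linked? : ∀ d → Dec (1 ≤ d × (near d ⊎ near (n ∸ d)))
  linked? d = 1 ℕ.≤? d ×-dec (near? d ⊎-dec near? (n ∸ d))

  linked-lower : ∀ d → d < h → does (linked? d) ≡ does (near? d)
  linked-lower d d<h = does-⇔ (mk⇔
    (λ where
      (_ , inj₁ d∈)   → d∈
      (_ , inj₂ n-d∈) → contradiction (ℕ.<⇒≤ (proj₂ (near-bounds n-d∈))) (ℕ.<⇒≱ h<n-d))
    (λ d∈ → proj₁ (near-bounds d∈) , inj₁ d∈))
    (linked? d) (near? d)
    where
    h<n-d : h < n ∸ d
    h<n-d = subst (_< n ∸ d) (ℕ.m+n∸n≡m h h) (ℕ.∸-monoʳ-< d<h (ℕ.m≤m+n h h))

  linked-upper : ∀ d → d < h → does (linked? (h ℕ.+ d)) ≡ does (far? d)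
  linked-upper d d<h = does-⇔ (mk⇔
    (λ where
      (_ , inj₁ h+d∈) → contradiction (ℕ.m≤m+n h d) (ℕ.<⇒≱ (proj₂ (near-bounds h+d∈)))
      (_ , inj₂ n-d∈) → Member-reflect {c = 2 ℕ.+ p} {6 ℕ.+ p} s+b≡h refl 2+p+4+p 6+p+p
        (ℕ.m∸n+n≡m (ℕ.<⇒≤ d<h)) (subst near n∸[h+d] n-d∈))
    (λ d∈ → s≤s z≤n , inj₂ (subst near (sym n∸[h+d])
      (Member-reflect {c = p} {4 ℕ.+ p} s+b≡h refl
        (trans (ℕ.+-comm p (6 ℕ.+ p)) 6+p+p) (trans (ℕ.+-comm (4 ℕ.+ p) (2 ℕ.+ p)) 2+p+4+p)
        (ℕ.m+[n∸m]≡n (ℕ.<⇒≤ d<h)) d∈))))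
    (linked? (h ℕ.+ d)) (far? d)
    where
    n∸[h+d] : n ∸ (h ℕ.+ d) ≡ h ∸ d
    n∸[h+d] = ℕ.[m+n]∸[m+o]≡n∸o h h d

  ∑-linked : ∀ f x → ∑ n (gate (does ∘ linked?) (λ d → f (d ℕ.+ x))) ≡ row b s h p f x
  ∑-linked f x = begin
    ∑ n (gate (does ∘ linked?) g)
      ≡⟨ ∑-split h h (gate (does ∘ linked?) g) ⟩
    ∑ h (gate (does ∘ linked?) g) + ∑ h (λ d → gate (does ∘ linked?) g (h ℕ.+ d))
      ≡⟨ cong₂ _+_
           (∑-cong h λ d d<h → cong (λ β → if β then g d else 0ℤ) (linked-lower d d<h))
           (∑-cong h λ d d<h → cong (λ β → if β then g (h ℕ.+ d) else 0ℤ) (linked-upper d d<h)) ⟩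
    ∑ h (gate (does ∘ near?) g) + ∑ h (gate (does ∘ far?) (g ∘ (h ℕ.+_)))
      ≡⟨ cong₂ _+_
           -- The isolated pair of `far` lies two places below that of `near`, so the gap lengths
           -- `2 + 2ρ` and `2ρ` trade places. The bound on the order is what makes them natural
           -- numbers.
           (∑-member b (2 ℕ.+ ρ ℕ.* 2) (ρ ℕ.* 2) (near-c a ρ) (ℕ.+-comm 4 (2 ℕ.+ p)) (near-s a ρ) refl s+b≡h g)
           (∑-member b (ρ ℕ.* 2) (2 ℕ.+ ρ ℕ.* 2) (far-c a ρ) (ℕ.+-comm 4 p) (far-s a ρ) refl s+b≡h (g ∘ (h ℕ.+_))) ⟩
    _ ≡⟨ cong₂ _+_
           (cong₂ (λ B C → B + (f (2 ℕ.+ (p ℕ.+ x)) + f (6 ℕ.+ (p ℕ.+ x))) + C) (shift 1) (shift s))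
           (cong₂ _+_ (cong₂ _+_ (shift′ 1) (cong₂ _+_ (cong f (ℕ.+-assoc h p x)) (cong f (ℕ.+-assoc h (4 ℕ.+ p) x)))) (shift′ s)) ⟩
    row b s h p f x ∎
    where
    g : ℕ → ℤ
    g d = f (d ℕ.+ x)
    near-c : ∀ a ρ → 2 ℕ.+ (suc a ℕ.+ ρ) ℕ.* 2 ≡ suc (suc (a ℕ.* 2)) ℕ.+ (2 ℕ.+ ρ ℕ.* 2)
    near-c = ℕSolver.solve-∀
    near-s : ∀ a ρ → suc ((4 ℕ.+ a ℕ.+ ρ ℕ.* 2) ℕ.* 2)
      ≡ suc (suc (a ℕ.* 2)) ℕ.+ (2 ℕ.+ ρ ℕ.* 2) ℕ.+ 1 ℕ.+ 3 ℕ.+ 1 ℕ.+ ρ ℕ.* 2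
    near-s = ℕSolver.solve-∀
    far-c : ∀ a ρ → (suc a ℕ.+ ρ) ℕ.* 2 ≡ suc (suc (a ℕ.* 2)) ℕ.+ ρ ℕ.* 2
    far-c = ℕSolver.solve-∀
    far-s : ∀ a ρ → suc ((4 ℕ.+ a ℕ.+ ρ ℕ.* 2) ℕ.* 2)
      ≡ suc (suc (a ℕ.* 2)) ℕ.+ ρ ℕ.* 2 ℕ.+ 1 ℕ.+ 3 ℕ.+ 1 ℕ.+ (2 ℕ.+ ρ ℕ.* 2)
    far-s = ℕSolver.solve-∀
    shift : ∀ o → segment g o b ≡ block b f (o ℕ.+ x)
    shift o = ∑-cong b λ i _ → cong f (rotate o i x)
      where
      rotate : ∀ o i x → o ℕ.+ i ℕ.+ x ≡ i ℕ.+ (o ℕ.+ x)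
      rotate = ℕSolver.solve-∀
    shift′ : ∀ o → segment (g ∘ (h ℕ.+_)) o b ≡ block b f (h ℕ.+ (o ℕ.+ x))
    shift′ o = ∑-cong b λ i _ → cong f (rotate h o i x)
      where
      rotate : ∀ h o i x → h ℕ.+ (o ℕ.+ i) ℕ.+ x ≡ i ℕ.+ (h ℕ.+ (o ℕ.+ x))
      rotate = ℕSolver.solve-∀

  ∑-Circ : ∀ f → Periodic _≡_ n f → ∀ x → x < n →
    ∑ n (gate (adjacent (ℕ.pred n) (S'' t n) x) f) ≡ row b s h p f x
  ∑-Circ f f-per x x<n = begin
    ∑ n (gate (adjacent (ℕ.pred n) (S'' t n) x) f)
      ≡⟨ ∑-adjacent (ℕ.pred n) (S'' t n) f f-per x x<n ⟩
    ∑ n (gate (linked (ℕ.pred n) (S'' t n)) (λ d → f (d ℕ.+ x)))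
      ≡⟨ ∑-cong n (λ d _ → cong₂ (λ u v → if (1 ≤ᵇ d) ∧ (u ∨ v) then f (d ℕ.+ x) else 0ℤ)
           (S''≡near d) (S''≡near (n ∸ d))) ⟩
    ∑ n (gate (does ∘ linked?) (λ d → f (d ℕ.+ x)))
      ≡⟨ ∑-linked f x ⟩
    row b s h p f x ∎

-- From rational to integral kernel vectors

-- Writing the normal form with denominator 1 directly makes injectivity a pattern match and `ι 0ℤ`
-- equal to `0ℚ` by computation.
ι : ℤ → ℚ
ι i = mkℚ i 0 (Coprime.sym (Coprime.1-coprimeTo ∣ i ∣))

ι-injective : ∀ {i j} → ι i ≡ ι j → i ≡ j
ι-injective refl = refl

ι-homo-+ : ∀ i j → ι (i + j) ≡ ι i ℚ.+ ι j
ι-homo-+ i j = ℚ.toℚᵘ-injective (ℚᵘ.≃-trans (*≡* (sum i j)) (ℚᵘ.≃-sym (ℚ.toℚᵘ-homo-+ (ι i) (ι j))))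
  where
  sum : ∀ i j → (i + j) * 1ℤ ≡ (i * 1ℤ + j * 1ℤ) * 1ℤ
  sum = solve-∀

ι-homo-* : ∀ i j → ι (i * j) ≡ ι i ℚ.* ι j
ι-homo-* i j = ℚ.toℚᵘ-injective (ℚᵘ.≃-sym (ℚ.toℚᵘ-homo-* (ι i) (ι j)))

ι-numerator : ∀ r → ι (↥ r) ≡ ι (↧ r) ℚ.* r
ι-numerator r@record{} = ℚ.toℚᵘ-injective
  (ℚᵘ.≃-trans (*≡* clear-fraction) (ℚᵘ.≃-sym (ℚ.toℚᵘ-homo-* (ι (↧ r)) r)))
  where
  clear-fraction : ↥ r * + (1 ℕ.* ↧ₙ r) ≡ ↧ r * ↥ r * 1ℤ
  clear-fraction = trans (cong (λ k → ↥ r * + k) (ℕ.*-identityˡ (↧ₙ r)))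
    (trans (ℤ.*-comm (↥ r) (↧ r)) (sym (ℤ.*-identityʳ (↧ r * ↥ r))))

ι-cancelˡ : ∀ D {x y} → ι +[1+ D ] ℚ.* x ≡ ι +[1+ D ] ℚ.* y → x ≡ y
ι-cancelˡ D {x} {y} eq = trans (sym (undo x)) (trans (cong (ℚ.1/ d ℚ.*_) eq) (undo y))
  where
  d = ι +[1+ D ]
  undo : ∀ x → ℚ.1/ d ℚ.* (d ℚ.* x) ≡ x
  undo x = trans (sym (ℚ.*-assoc (ℚ.1/ d) d x))
    (trans (cong (ℚ._* x) (ℚ.*-inverseˡ d)) (ℚ.*-identityˡ x))

-- The multiplier is the product of all denominators, stored as its predecessor `D` so that it is
-- visibly nonzero and can be cancelled later.
clear-denominators : ∀ n (w : Fin n → ℚ) →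
  Σ ℕ λ D → Σ (Fin n → ℤ) λ z → ∀ i → ι (z i) ≡ ι +[1+ D ] ℚ.* w i
clear-denominators zero    w = 0 , (λ ()) , λ ()
clear-denominators (suc n) w with clear-denominators n (w ∘ fsuc)
... | D , z , z≡ = d , z′ , z′≡
  where
  r = w fzero
  d = ℕ.pred (suc D ℕ.* ↧ₙ r)
  z′ : Fin (suc n) → ℤ
  z′ fzero    = +[1+ D ] * ↥ r
  z′ (fsuc i) = ↧ r * z i
  d≡ : ι +[1+ d ] ≡ ι +[1+ D ] ℚ.* ι (↧ r)
  d≡ = ι-homo-* +[1+ D ] (↧ r)
  z′≡ : ∀ i → ι (z′ i) ≡ ι +[1+ d ] ℚ.* w i
  z′≡ fzero = begin
    ι (+[1+ D ] * ↥ r)                   ≡⟨ ι-homo-* +[1+ D ] (↥ r) ⟩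
    ι +[1+ D ] ℚ.* ι (↥ r)               ≡⟨ cong (ι +[1+ D ] ℚ.*_) (ι-numerator r) ⟩
    ι +[1+ D ] ℚ.* (ι (↧ r) ℚ.* r)       ≡⟨ sym (ℚ.*-assoc (ι +[1+ D ]) (ι (↧ r)) r) ⟩
    ι +[1+ D ] ℚ.* ι (↧ r) ℚ.* r         ≡⟨ cong (ℚ._* r) (sym d≡) ⟩
    ι +[1+ d ] ℚ.* r                     ∎
  z′≡ (fsuc i) = begin
    ι (↧ r * z i)                                ≡⟨ ι-homo-* (↧ r) (z i) ⟩
    ι (↧ r) ℚ.* ι (z i)                          ≡⟨ cong (ι (↧ r) ℚ.*_) (z≡ i) ⟩
    ι (↧ r) ℚ.* (ι +[1+ D ] ℚ.* w (fsuc i))      ≡⟨ sym (ℚ.*-assoc (ι (↧ r)) (ι +[1+ D ]) (w (fsuc i))) ⟩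
    ι (↧ r) ℚ.* ι +[1+ D ] ℚ.* w (fsuc i)
      ≡⟨ cong (ℚ._* w (fsuc i)) (trans (ℚ.*-comm (ι (↧ r)) (ι +[1+ D ])) (sym d≡)) ⟩
    ι +[1+ d ] ℚ.* w (fsuc i)                    ∎

sumFin-ι : ∀ {n} (f : ℕ → ℤ) (g : Fin n → ℚ) → (∀ i → g i ≡ ι (f (toℕ i))) → sumFin g ≡ ι (∑ n f)
sumFin-ι {zero}  f g g≡ = refl
sumFin-ι {suc n} f g g≡ = trans (cong₂ ℚ._+_ (g≡ fzero) (sumFin-ι (f ∘ suc) (g ∘ fsuc) (g≡ ∘ fsuc)))
  (sym (ι-homo-+ (f 0) (∑ n (f ∘ suc))))

sumFin-*ˡ : ∀ {n} c (f g : Fin n → ℚ) → (∀ i → g i ≡ c ℚ.* f i) → sumFin g ≡ c ℚ.* sumFin f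
sumFin-*ˡ {zero}  c f g g≡ = sym (ℚ.*-zeroʳ c)
sumFin-*ˡ {suc n} c f g g≡ = trans (cong₂ ℚ._+_ (g≡ fzero) (sumFin-*ˡ c (f ∘ fsuc) (g ∘ fsuc) (g≡ ∘ fsuc)))
  (sym (ℚ.*-distribˡ-+ c (f fzero) (sumFin (f ∘ fsuc))))

countFin-∑ : ∀ {n} (χ : ℕ → Bool) → + countFin {n} (χ ∘ toℕ) ≡ ∑ n (gate χ (λ _ → 1ℤ))
countFin-∑ {zero}  χ = refl
countFin-∑ {suc n} χ = trans (ℤ.pos-+ (if χ 0 then 1 else 0) (countFin {n} (χ ∘ suc ∘ toℕ)))
  (cong₂ _+_ (head (χ 0)) (countFin-∑ {n} (χ ∘ suc)))
  where
  head : ∀ β → + (if β then 1 else 0) ≡ (if β then 1ℤ else 0ℤ)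
  head true  = refl
  head false = refl

if-ι : ∀ β i → (if β then 1ℚ else 0ℚ) ℚ.* ι i ≡ ι (if β then i else 0ℤ)
if-ι true  i = ℚ.*-identityˡ (ι i)
if-ι false i = ℚ.*-zeroˡ (ι i)

-- The alternating vector and periodic extension

alternating : ℕ → ℤ
alternating zero    = 1ℤ
alternating (suc x) = - alternating x

alternating≢0 : ∀ x → alternating x ≢ 0ℤ
alternating≢0 (suc x) eq = alternating≢0 x (trans (sym (ℤ.neg-involutive _)) (cong -_ eq))

alternating-period2 : Periodic _≡_ 2 alternating
alternating-period2 x = ℤ.neg-involutive (alternating x)

alternating-unique : ∀ {f : ℕ → ℤ} → (∀ x → f (suc x) ≡ - f x) → ∀ x → f x ≡ alternating x * f 0
alternating-unique {f} f-alt zero    = sym (ℤ.*-identityˡ (f 0))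
alternating-unique {f} f-alt (suc x) = trans (f-alt x) (trans (cong -_ (alternating-unique {f} f-alt x))
  (ℤ.neg-distribˡ-* (alternating x) (f 0)))

module _ (m : ℕ) where
  private n = suc m

  extend : {A : Set} → (Fin n → A) → ℕ → A
  extend z x = z (x mod n)

  extend-toℕ : {A : Set} (z : Fin n → A) → ∀ i → extend z (toℕ i) ≡ z i
  extend-toℕ z i = cong z (toℕ-injective
    (trans (toℕ-fromℕ< (m%n<n (toℕ i) n)) (m<n⇒m%n≡m (toℕ<n i))))

  extend-periodic : {A : Set} (z : Fin n → A) → Periodic _≡_ n (extend z)
  extend-periodic z x = cong z (toℕ-injective (begin
    toℕ ((n ℕ.+ x) mod n) ≡⟨ toℕ-fromℕ< (m%n<n (n ℕ.+ x) n) ⟩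
    (n ℕ.+ x) % n         ≡⟨ cong (_% n) (ℕ.+-comm n x) ⟩
    (x ℕ.+ n) % n         ≡⟨ [m+n]%n≡m%n x n ⟩
    x % n                 ≡⟨ sym (toℕ-fromℕ< (m%n<n x n)) ⟩
    toℕ (x mod n)         ∎))

  periodic-vanishing : ∀ {f : ℕ → ℤ} → Periodic _≡_ n f → (∀ x → x < n → f x ≡ 0ℤ) → ∀ x → f x ≡ 0ℤ
  periodic-vanishing {f} f-per f≡0 x = begin
    f x                            ≡⟨ cong f (trans (m≡m%n+[m/n]*n x n) (ℕ.+-comm (x % n) _)) ⟩
    f (x / n ℕ.* n ℕ.+ x % n)      ≡⟨ periodic-* isEquivalence {f = f} (x / n) f-per (x % n) ⟩
    f (x % n)                      ≡⟨ f≡0 (x % n) (m%n<n x n) ⟩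
    0ℤ                             ∎

-- Degree and kernel of the graph

module _ (a ρ : ℕ) where
  open Parameters a ρ

  private
    G = Circ n (S'' t n)

    adj : ℕ → ℕ → Bool
    adj = adjacent (ℕ.pred n) (S'' t n)

  Circ-row : ∀ f → Periodic _≡_ n f → ∀ i →
    sumFin (λ j → adjMatrix G i j ℚ.* ι (f (toℕ j))) ≡ ι (row b s h p f (toℕ i))
  Circ-row f f-per i = trans
    (sumFin-ι {n} (gate (adj (toℕ i)) f) (λ j → adjMatrix G i j ℚ.* ι (f (toℕ j))) λ j → if-ι (adj (toℕ i) (toℕ j)) (f (toℕ j)))
    (cong ι (∑-Circ f f-per (toℕ i) (toℕ<n i)))

  period2⇒n : ∀ {f : ℕ → ℤ} → Periodic _≡_ 2 f → Periodic _≡_ n f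
  period2⇒n {f} f-per x = trans (cong (λ k → f (k ℕ.+ x)) (double q)) (periodic-* isEquivalence {f = f} (q ℕ.+ q) f-per x)
    where
    double : ∀ q → q ℕ.* 2 ℕ.+ q ℕ.* 2 ≡ (q ℕ.+ q) ℕ.* 2
    double = ℕSolver.solve-∀

  Circ-regular : IsRegular (4 ℕ.* t) G
  Circ-regular i = ℤ.+-injective (begin
    + countFin (G i)
      ≡⟨ countFin-∑ {n} (adj (toℕ i)) ⟩
    ∑ n (gate (adj (toℕ i)) (λ _ → 1ℤ))
      ≡⟨ ∑-Circ (λ _ → 1ℤ) (λ _ → refl) (toℕ i) (toℕ<n i) ⟩
    row b s h p (λ _ → 1ℤ) (toℕ i)
      ≡⟨ row-period2 a σ j {λ _ → 1ℤ} (λ _ → refl) (toℕ i) ⟩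
    + (suc a ℕ.* 4 ℕ.* 2)
      ≡⟨ cong +_ (degree a) ⟩
    + (4 ℕ.* t) ∎)
    where
    degree : ∀ a → suc a ℕ.* 4 ℕ.* 2 ≡ 4 ℕ.* (2 ℕ.+ a ℕ.* 2)
    degree = ℕSolver.solve-∀

  alternating-kernel : InKernel G (ι ∘ alternating ∘ toℕ)
  alternating-kernel i = begin
    sumFin (λ j → adjMatrix G i j ℚ.* ι (alternating (toℕ j)))
      ≡⟨ Circ-row alternating (period2⇒n {alternating} alternating-period2) i ⟩
    ι (row b s h p alternating x)
      ≡⟨ cong ι (row-period2 a σ j {alternating} alternating-period2 x) ⟩
    ι (+ suc a * + 4 * (alternating x - alternating x))
      ≡⟨ cong (λ k → ι (+ suc a * + 4 * k)) (ℤ.+-inverseʳ (alternating x)) ⟩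
    ι (+ suc a * + 4 * 0ℤ)
      ≡⟨ cong ι (ℤ.*-zeroʳ (+ suc a * + 4)) ⟩
    0ℚ ∎
    where x = toℕ i

  -- After clearing denominators and extending periodically, the integral result fixes every entry
  -- by the entry at 0. The scalar is `w fzero` because `alternating 0` is 1.
  kernel-alternating : ∀ w → InKernel G w → ∀ i → w i ≡ w fzero ℚ.* ι (alternating (toℕ i))
  kernel-alternating w w∈ker i with clear-denominators n w
  ... | D , z , z≡ = ι-cancelˡ D (begin
    d ℚ.* w i                          ≡⟨ sym (z≡ i) ⟩
    ι (z i)                            ≡⟨ cong ι (sym (extend-toℕ (ℕ.pred n) z i)) ⟩
    ι (f (toℕ i))                      ≡⟨ cong ι (alternating-unique {f} (row≡0⇒alternating a σ j {f} f-per row≡0) (toℕ i)) ⟩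
    ι (alternating (toℕ i) * z fzero)  ≡⟨ ι-homo-* (alternating (toℕ i)) (z fzero) ⟩
    A ℚ.* ι (z fzero)                  ≡⟨ cong (A ℚ.*_) (z≡ fzero) ⟩
    A ℚ.* (d ℚ.* w fzero)              ≡⟨ ℚ.*-comm A (d ℚ.* w fzero) ⟩
    d ℚ.* w fzero ℚ.* A                ≡⟨ ℚ.*-assoc d (w fzero) A ⟩
    d ℚ.* (w fzero ℚ.* A)              ∎)
    where
    d = ι +[1+ D ]
    A = ι (alternating (toℕ i))
    f : ℕ → ℤ
    f = extend (ℕ.pred n) z
    f-per : Periodic _≡_ n f
    f-per = extend-periodic (ℕ.pred n) z
    ιf≡ : ∀ k → ι (f (toℕ k)) ≡ d ℚ.* w k
    ιf≡ k = trans (cong ι (extend-toℕ (ℕ.pred n) z k)) (z≡ k)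
    row≡0-Fin : ∀ i → row b s h p f (toℕ i) ≡ 0ℤ
    row≡0-Fin i = ι-injective (begin
      ι (row b s h p f (toℕ i))
        ≡⟨ sym (Circ-row f f-per i) ⟩
      sumFin (λ k → adjMatrix G i k ℚ.* ι (f (toℕ k)))
        ≡⟨ sumFin-*ˡ {n} d (λ k → adjMatrix G i k ℚ.* w k)
             (λ k → adjMatrix G i k ℚ.* ι (f (toℕ k))) (λ k → scale (adjMatrix G i k) k) ⟩
      d ℚ.* sumFin (λ k → adjMatrix G i k ℚ.* w k)
        ≡⟨ cong (d ℚ.*_) (w∈ker i) ⟩
      d ℚ.* 0ℚ
        ≡⟨ ℚ.*-zeroʳ d ⟩
      0ℚ ∎)
      where
      scale : ∀ x k → x ℚ.* ι (f (toℕ k)) ≡ d ℚ.* (x ℚ.* w k)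
      scale x k = trans (cong (x ℚ.*_) (ιf≡ k)) (trans (sym (ℚ.*-assoc x d (w k)))
        (trans (cong (ℚ._* w k) (ℚ.*-comm x d)) (ℚ.*-assoc d x (w k))))
    -- The kernel condition gives the row equations only for `x < n`; periodicity of the row carries
    -- them to all `x`.
    row-per : Periodic _≡_ n (row b s h p f)
    row-per x = trans (sym (row-shift b s h p n f x)) (row-cong b s h p f-per x)
    row≡0 : ∀ x → row b s h p f x ≡ 0ℤ
    row≡0 = periodic-vanishing (ℕ.pred n) {row b s h p f} row-per λ x x<n →
      subst (λ x → row b s h p f x ≡ 0ℤ) (toℕ-fromℕ< x<n) (row≡0-Fin (fromℕ< x<n))

  Circ-nut : IsNut G
  Circ-nut = s≤s (s≤s z≤n) , ι ∘ alternating ∘ toℕ , alternating-kernel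
    , (λ i v≡0 → alternating≢0 (toℕ i) (ι-injective v≡0))
    , λ w w∈ker → w fzero , kernel-alternating w w∈ker

-- From the hypotheses to the parameters

even⇒2+a*2 : ∀ {t} → 4 ≤ t → t % 2 ≡ 0 → ∃ λ a → t ≡ 2 ℕ.+ a ℕ.* 2
even⇒2+a*2 {t} 4≤t t%2≡0 = halve (t / 2) (trans (m≡m%n+[m/n]*n t 2) (cong (ℕ._+ t / 2 ℕ.* 2) t%2≡0))
  where
  halve : ∀ u → t ≡ u ℕ.* 2 → ∃ λ a → t ≡ 2 ℕ.+ a ℕ.* 2
  halve zero    t≡0 = contradiction (subst (4 ≤_) t≡0 4≤t) λ ()
  halve (suc a) t≡  = a , t≡

-- Here `4t + 12 = 8 (a + 2) + 4` and `n = 8 (n / 8) + 4`, so the bound becomes `a + 2 ≤ n / 8` and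
-- `ρ` is the difference.
order-parameter : ∀ {a n} → 4 ℕ.* (2 ℕ.+ a ℕ.* 2) ℕ.+ 12 ≤ n → n % 8 ≡ 4 → ∃ λ ρ → n ≡ Parameters.n a ρ
order-parameter {a} {n} 4t+12≤n n%8≡4 = ρ , trans n≡ (trans (cong (λ k → k ℕ.* 8 ℕ.+ 4) (sym 2+a+ρ≡n/8)) (expand a ρ))
  where
  n≡ : n ≡ n / 8 ℕ.* 8 ℕ.+ 4
  n≡ = trans (m≡m%n+[m/n]*n n 8) (trans (cong (ℕ._+ n / 8 ℕ.* 8) n%8≡4) (ℕ.+-comm 4 (n / 8 ℕ.* 8)))
  collect : ∀ a → 4 ℕ.* (2 ℕ.+ a ℕ.* 2) ℕ.+ 12 ≡ (2 ℕ.+ a) ℕ.* 8 ℕ.+ 4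
  collect = ℕSolver.solve-∀
  2+a≤n/8 : 2 ℕ.+ a ≤ n / 8
  2+a≤n/8 = ℕ.*-cancelʳ-≤ (2 ℕ.+ a) (n / 8) 8
    (ℕ.+-cancelʳ-≤ 4 ((2 ℕ.+ a) ℕ.* 8) (n / 8 ℕ.* 8) (subst₂ _≤_ (collect a) n≡ 4t+12≤n))
  ρ : ℕ
  ρ = n / 8 ∸ (2 ℕ.+ a)
  2+a+ρ≡n/8 : 2 ℕ.+ a ℕ.+ ρ ≡ n / 8
  2+a+ρ≡n/8 = ℕ.m+[n∸m]≡n 2+a≤n/8
  expand : ∀ a ρ → (2 ℕ.+ a ℕ.+ ρ) ℕ.* 8 ℕ.+ 4
    ≡ (suc (suc a ℕ.+ ρ) ℕ.* 2 ℕ.+ 1) ℕ.* 2 ℕ.+ (suc (suc a ℕ.+ ρ) ℕ.* 2 ℕ.+ 1) ℕ.* 2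
  expand = ℕSolver.solve-∀

-- With `t` and `n` as variables the two equations can be matched with `refl`, which avoids
-- transport along them.
Circ-regular-nut : ∀ {t n} a ρ → t ≡ 2 ℕ.+ a ℕ.* 2 → n ≡ Parameters.n a ρ →
  IsRegular (4 ℕ.* t) (Circ n (S'' t n)) × IsNut (Circ n (S'' t n))
Circ-regular-nut a ρ refl refl = Circ-regular a ρ , Circ-nut a ρ

theorem5p1 : (t n : ℕ) → 4 ≤ t → t % 2 ≡ 0 → 4 ℕ.* t ℕ.+ 12 ≤ n → n % 8 ≡ 4 →
    IsRegular (4 ℕ.* t) (Circ n (S'' t n)) × IsNut (Circ n (S'' t n))
theorem5p1 t n 4≤t t%2≡0 4t+12≤n n%8≡4 =
  let a , t≡ = even⇒2+a*2 4≤t t%2≡0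
      ρ , n≡ = order-parameter {a} (subst (λ t → 4 ℕ.* t ℕ.+ 12 ≤ n) t≡ 4t+12≤n) n%8≡4
  in Circ-regular-nut a ρ t≡ n≡
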